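{- Let $n$ be a positive integer and let $p>n+1$ be a prime. Define the polynomial $$F_n(x)=\sum_{0<i_1<\cdots<i_n<p}\frac{x^{i_1}}{i_1\cdots i_n}\in\mathbb{Z}_p[x],$$ where the sum ranges over integers $i_1,\dots,i_n$. Then $$F_n(1-x)\equiv(-1)^{n-1}F_n(x)\pmod p,$$ i.e., every coefficient of the polynomial $F_n(1-x)-(-1)^{n-1}F_n(x)$ is divisible by $p$ in $\mathbb{Z}_p$.
   Context: $\mathbb{Z}_p$ denotes the ring of $p$-adic integers (the integral ring of the $p$-adic field $\mathbb{Q}_p$); the coefficients $1/(i_1\cdots i_n)$ lie in $\mathbb{Z}_p$ since each $i_j<p$. -}

module Defs where

open import Level using (0ℓ)
open import Algebra.Bundles using (CommutativeRing)
open import Data.Integer as ℤ using (ℤ; +_; 0ℤ; 1ℤ)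
import Data.Integer.Properties as ℤ
open import Data.Integer.Divisibility.Signed as ℤ using (divides)
open import Data.Integer.Solver using (module +-*-Solver)
open import Data.List using (List; []; _∷_; _++_; map; concatMap; foldr; filter; replicate; upTo)
open import Data.Nat.ListAction using (product)
open import Data.Nat as ℕ using (ℕ; zero; suc; NonZero)
open import Data.Nat.Coprimality using (Coprime; coprime?; coprime-Bézout)
open import Data.Nat.GCD using (module Bézout)
open import Data.Product using (∃; _,_; proj₁; proj₂)
open import Data.Vec using (Vec; []; _∷_; head; toList)
open import Function using (_$_)
open import Relation.Binary.PropositionalEquality as ≡ using (_≡_; refl; cong; cong₂; subst)
open import Relation.Nullary using (Dec; yes; no; contradiction)

module Padic (p : ℕ) where

  -- ℤₚ is the inverse limit of the rings ℤ/pᵏ.  An element is given by integer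
  -- representatives of its residues, so equality is congruence mod pᵏ for all k.
  record ℤₚ : Set where
    no-eta-equality
    field
      residue  : ℕ → ℤ
      coherent : ∀ k → (+ p) ℤ.^ k ℤ.∣ residue (suc k) ℤ.- residue k
  open ℤₚ public

  infix 4 _≈_
  record _≈_ (x y : ℤₚ) : Set where
    constructor mk≈
    field
      congruent : ∀ k → (+ p) ℤ.^ k ℤ.∣ residue x k ℤ.- residue y k
  open _≈_ public

  private
    open +-*-Solver

    ∣-add : ∀ {d} a b a′ b′ → d ℤ.∣ a ℤ.- a′ → d ℤ.∣ b ℤ.- b′ →
            d ℤ.∣ (a ℤ.+ b) ℤ.- (a′ ℤ.+ b′)
    ∣-add {d} a b a′ b′ u v = subst (d ℤ.∣_)
      (solve 4 (λ a b a′ b′ → (a :- a′) :+ (b :- b′) := (a :+ b) :- (a′ :+ b′))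
        refl a b a′ b′)
      (ℤ.∣m∣n⇒∣m+n u v)

    ∣-mul : ∀ {d} a b a′ b′ → d ℤ.∣ a ℤ.- a′ → d ℤ.∣ b ℤ.- b′ →
            d ℤ.∣ (a ℤ.* b) ℤ.- (a′ ℤ.* b′)
    ∣-mul {d} a b a′ b′ u v = subst (d ℤ.∣_)
      (solve 4 (λ a b a′ b′ → (a :- a′) :* b :+ a′ :* (b :- b′) := (a :* b) :- (a′ :* b′))
        refl a b a′ b′)
      (ℤ.∣m∣n⇒∣m+n (ℤ.∣m⇒∣m*n b u) (ℤ.∣n⇒∣m*n a′ v))

    ∣-neg : ∀ {d} a a′ → d ℤ.∣ a ℤ.- a′ → d ℤ.∣ (ℤ.- a) ℤ.- (ℤ.- a′)
    ∣-neg {d} a a′ u = subst (d ℤ.∣_)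
      (solve 2 (λ a a′ → :- (a :- a′) := (:- a) :- (:- a′)) refl a a′)
      (ℤ.∣m⇒∣-m u)

    ∣-swap : ∀ {d} a a′ → d ℤ.∣ a ℤ.- a′ → d ℤ.∣ a′ ℤ.- a
    ∣-swap {d} a a′ u = subst (d ℤ.∣_)
      (solve 2 (λ a a′ → :- (a :- a′) := a′ :- a) refl a a′)
      (ℤ.∣m⇒∣-m u)

    ∣-chain : ∀ {d} a b c → d ℤ.∣ a ℤ.- b → d ℤ.∣ b ℤ.- c → d ℤ.∣ a ℤ.- c
    ∣-chain {d} a b c u v = subst (d ℤ.∣_)
      (solve 3 (λ a b c → (a :- b) :+ (b :- c) := a :- c) refl a b c)
      (ℤ.∣m∣n⇒∣m+n u v)

    ∣-same : ∀ {d a b} → a ≡ b → d ℤ.∣ a ℤ.- b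
    ∣-same {d} {a} refl = divides 0ℤ (ℤ.+-inverseʳ a)

  infixl 6 _+_
  infixl 7 _*_
  infix  8 -_

  ι : ℤ → ℤₚ
  residue  (ι a) k = a
  coherent (ι a) k = ∣-same {a = a} refl

  _+_ : ℤₚ → ℤₚ → ℤₚ
  residue  (x + y) k = residue x k ℤ.+ residue y k
  coherent (x + y) k = ∣-add (residue x (suc k)) _ _ _ (coherent x k) (coherent y k)

  _*_ : ℤₚ → ℤₚ → ℤₚ
  residue  (x * y) k = residue x k ℤ.* residue y k
  coherent (x * y) k = ∣-mul (residue x (suc k)) _ _ _ (coherent x k) (coherent y k)

  -_ : ℤₚ → ℤₚ
  residue  (- x) k = ℤ.- residue x k
  coherent (- x) k = ∣-neg (residue x (suc k)) _ (coherent x k)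

  ≡⇒≈ : ∀ {x y} → (∀ k → residue x k ≡ residue y k) → x ≈ y
  ≡⇒≈ eq = mk≈ λ k → ∣-same (eq k)

  ℤₚ-commutativeRing : CommutativeRing 0ℓ 0ℓ
  ℤₚ-commutativeRing = record
    { Carrier = ℤₚ
    ; _≈_ = _≈_
    ; _+_ = _+_
    ; _*_ = _*_
    ; -_ = -_
    ; 0# = ι 0ℤ
    ; 1# = ι 1ℤ
    ; isCommutativeRing = record
      { isRing = record
        { +-isAbelianGroup = record
          { isGroup = record
            { isMonoid = record
              { isSemigroup = record
                { isMagma = record
                  { isEquivalence = record
                    { refl  = ≡⇒≈ λ _ → refl
                    ; sym   = λ {x} x≈y → mk≈ λ k →
                        ∣-swap (residue x k) _ (congruent x≈y k)
                    ; trans = λ {x} x≈y y≈z → mk≈ λ k →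
                        ∣-chain (residue x k) _ _ (congruent x≈y k) (congruent y≈z k)
                    }
                  ; ∙-cong = λ {x} x≈y u≈v → mk≈ λ k →
                      ∣-add (residue x k) _ _ _ (congruent x≈y k) (congruent u≈v k)
                  }
                ; assoc = λ x y z → ≡⇒≈ λ k →
                    ℤ.+-assoc (residue x k) (residue y k) (residue z k)
                }
              ; identity = (λ x → ≡⇒≈ λ k → ℤ.+-identityˡ (residue x k))
                         , (λ x → ≡⇒≈ λ k → ℤ.+-identityʳ (residue x k))
              }
            ; inverse = (λ x → ≡⇒≈ λ k → ℤ.+-inverseˡ (residue x k))
                      , (λ x → ≡⇒≈ λ k → ℤ.+-inverseʳ (residue x k))
            ; ⁻¹-cong = λ {x} x≈y → mk≈ λ k → ∣-neg (residue x k) _ (congruent x≈y k)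
            }
          ; comm = λ x y → ≡⇒≈ λ k → ℤ.+-comm (residue x k) (residue y k)
          }
        ; *-cong = λ {x} x≈y u≈v → mk≈ λ k →
            ∣-mul (residue x k) _ _ _ (congruent x≈y k) (congruent u≈v k)
        ; *-assoc = λ x y z → ≡⇒≈ λ k →
            ℤ.*-assoc (residue x k) (residue y k) (residue z k)
        ; *-identity = (λ x → ≡⇒≈ λ k → ℤ.*-identityˡ (residue x k))
                     , (λ x → ≡⇒≈ λ k → ℤ.*-identityʳ (residue x k))
        ; distrib = (λ x y z → ≡⇒≈ λ k →
                      ℤ.*-distribˡ-+ (residue x k) (residue y k) (residue z k))
                  , (λ x y z → ≡⇒≈ λ k →
                      ℤ.*-distribʳ-+ (residue x k) (residue y k) (residue z k))
        }
      ; *-comm = λ x y → ≡⇒≈ λ k → ℤ.*-comm (residue x k) (residue y k)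
      }
    }

  inverse-mod-p : ∀ m → Coprime m p → ∃ λ b → (+ p) ℤ.∣ 1ℤ ℤ.- (+ m) ℤ.* b
  inverse-mod-p m c with coprime-Bézout c
  ... | Bézout.+- x y eq = + x , divides (ℤ.- (+ y)) (begin
      1ℤ ℤ.- (+ m) ℤ.* (+ x)
        ≡⟨ cong (λ t → 1ℤ ℤ.- t) (ℤ.*-comm (+ m) (+ x)) ⟩
      1ℤ ℤ.- (+ x) ℤ.* (+ m)
        ≡⟨ cong (λ t → 1ℤ ℤ.- t) (ℤ.pos-* x m) ⟨
      1ℤ ℤ.- (+ (x ℕ.* m))
        ≡⟨ cong (λ t → 1ℤ ℤ.- (+ t)) eq ⟨
      1ℤ ℤ.- (1ℤ ℤ.+ (+ (y ℕ.* p)))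
        ≡⟨ cong (λ t → 1ℤ ℤ.- (1ℤ ℤ.+ t)) (ℤ.pos-* y p) ⟩
      1ℤ ℤ.- (1ℤ ℤ.+ (+ y) ℤ.* (+ p))
        ≡⟨ solve 2 (λ y p → con 1ℤ :- (con 1ℤ :+ y :* p) := (:- y) :* p) refl (+ y) (+ p) ⟩
      (ℤ.- (+ y)) ℤ.* (+ p) ∎)
    where open ≡.≡-Reasoning
  ... | Bézout.-+ x y eq = ℤ.- (+ x) , divides (+ y) (begin
      1ℤ ℤ.- (+ m) ℤ.* (ℤ.- (+ x))
        ≡⟨ solve 2 (λ m x → con 1ℤ :- m :* (:- x) := con 1ℤ :+ x :* m) refl (+ m) (+ x) ⟩
      1ℤ ℤ.+ (+ x) ℤ.* (+ m)
        ≡⟨ cong (λ t → 1ℤ ℤ.+ t) (ℤ.pos-* x m) ⟨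
      + (1 ℕ.+ x ℕ.* m)
        ≡⟨ cong +_ eq ⟩
      + (y ℕ.* p)
        ≡⟨ ℤ.pos-* y p ⟩
      (+ y) ℤ.* (+ p) ∎)
    where open ≡.≡-Reasoning

  geometric : ℤ → ℕ → ℤ
  geometric e zero    = 0ℤ
  geometric e (suc k) = geometric e k ℤ.+ e ℤ.^ k

  private
    ^-mono-∣ : ∀ {d e} k → d ℤ.∣ e → d ℤ.^ k ℤ.∣ e ℤ.^ k
    ^-mono-∣ zero    d∣e = ℤ.∣-refl
    ^-mono-∣ {d} (suc k) (divides q refl) with ^-mono-∣ k (divides {d} q refl)
    ... | divides r eq = divides (q ℤ.* r) (≡.trans
      (cong (q ℤ.* d ℤ.*_) eq)
      (solve 4 (λ q d r s → q :* d :* (r :* s) := q :* r :* (d :* s)) refl q d r (d ℤ.^ k)))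

    geometric-closed : ∀ a b k → let e = 1ℤ ℤ.- a ℤ.* b in
                       a ℤ.* (b ℤ.* geometric e k) ℤ.- 1ℤ ≡ ℤ.- (e ℤ.^ k)
    geometric-closed a b zero =
      solve 2 (λ a b → a :* (b :* con 0ℤ) :- con 1ℤ := :- con 1ℤ) refl a b
    geometric-closed a b (suc k) = begin
      a ℤ.* (b ℤ.* (g ℤ.+ t)) ℤ.- 1ℤ
        ≡⟨ solve 4 (λ a b g t → a :* (b :* (g :+ t)) :- con 1ℤ
                             := (a :* (b :* g) :- con 1ℤ) :+ a :* b :* t) refl a b g t ⟩
      (a ℤ.* (b ℤ.* g) ℤ.- 1ℤ) ℤ.+ a ℤ.* b ℤ.* t
        ≡⟨ cong (ℤ._+ a ℤ.* b ℤ.* t) (geometric-closed a b k) ⟩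
      ℤ.- t ℤ.+ a ℤ.* b ℤ.* t
        ≡⟨ solve 3 (λ a b t → :- t :+ a :* b :* t := :- ((con 1ℤ :- a :* b) :* t)) refl a b t ⟩
      ℤ.- ((1ℤ ℤ.- a ℤ.* b) ℤ.* t) ∎
      where
      open ≡.≡-Reasoning
      g = geometric (1ℤ ℤ.- a ℤ.* b) k
      t = (1ℤ ℤ.- a ℤ.* b) ℤ.^ k

  -- If mb ≡ 1 (mod p), then 1/m = b/(1 - e) = b(1 + e + e² + ⋯) with e = 1 - mb ∈ pℤ.
  inverse : ∀ m → Coprime m p → ℤₚ
  residue  (inverse m c) k =
    let b = proj₁ (inverse-mod-p m c)
    in b ℤ.* geometric (1ℤ ℤ.- (+ m) ℤ.* b) k
  coherent (inverse m c) k = subst ((+ p) ℤ.^ k ℤ.∣_)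
      (solve 3 (λ b g t → b :* t := b :* (g :+ t) :- b :* g) refl b (geometric e k) (e ℤ.^ k))
      (ℤ.∣n⇒∣m*n b (^-mono-∣ k (proj₂ (inverse-mod-p m c))))
    where
    b = proj₁ (inverse-mod-p m c)
    e = 1ℤ ℤ.- (+ m) ℤ.* b

  inverse-correct : ∀ m (c : Coprime m p) → ι (+ m) * inverse m c ≈ ι 1ℤ
  inverse-correct m c = mk≈ λ k →
    subst ((+ p) ℤ.^ k ℤ.∣_) (≡.sym (geometric-closed (+ m) (proj₁ (inverse-mod-p m c)) k))
      (ℤ.∣m⇒∣-m (^-mono-∣ k (proj₂ (inverse-mod-p m c))))

  inverseOrZero : ∀ m → Dec (Coprime m p) → ℤₚ
  inverseOrZero m (yes c) = inverse m c
  inverseOrZero m (no  _) = ι 0ℤ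

  -- Total for convenience; the value 0 is a dummy, taken only when m is not coprime to p.
  1/_ : ℕ → ℤₚ
  1/ m = inverseOrZero m (coprime? m p)

  1/-correct : ∀ m → Coprime m p → ι (+ m) * 1/ m ≈ ι 1ℤ
  1/-correct m c = go (coprime? m p)
    where
    go : (d : Dec (Coprime m p)) → ι (+ m) * inverseOrZero m d ≈ ι 1ℤ
    go (yes c′) = inverse-correct m c′
    go (no  ¬c) = contradiction (λ {d} → c {d}) ¬c

module Polynomial {c ℓ} (R : CommutativeRing c ℓ) where

  open CommutativeRing R
  open import Algebra.Properties.Semiring.Divisibility semiring using (_∣_)

  -- Coefficients in order of increasing degree; trailing zeros are allowed.
  Poly : Set c
  Poly = List Carrier

  coeff : Poly → ℕ → Carrier
  coeff []      k       = 0#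
  coeff (a ∷ f) zero    = a
  coeff (a ∷ f) (suc k) = coeff f k

  constant : Carrier → Poly
  constant a = a ∷ []

  monomial : Carrier → ℕ → Poly
  monomial a k = replicate k 0# ++ constant a

  X : Poly
  X = monomial 1# 1

  infixl 6 _⊕_ _⊖_
  infixl 7 _⊗_
  infixr 7 _·_

  _⊕_ : Poly → Poly → Poly
  []      ⊕ g       = g
  (a ∷ f) ⊕ []      = a ∷ f
  (a ∷ f) ⊕ (b ∷ g) = (a + b) ∷ (f ⊕ g)

  _·_ : Carrier → Poly → Poly
  a · f = map (a *_) f

  _⊖_ : Poly → Poly → Poly
  f ⊖ g = f ⊕ map -_ g

  _⊗_ : Poly → Poly → Poly
  []      ⊗ g = []
  (a ∷ f) ⊗ g = a · g ⊕ (0# ∷ f ⊗ g)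

  ∑ : List Poly → Poly
  ∑ = foldr _⊕_ []

  -- f ⟨ g ⟩ is f(g(x)), by Horner's rule.
  infix 8 _⟨_⟩
  _⟨_⟩ : Poly → Poly → Poly
  []      ⟨ g ⟩ = []
  (a ∷ f) ⟨ g ⟩ = constant a ⊕ g ⊗ f ⟨ g ⟩

  infix 4 _≡_[mod_]
  _≡_[mod_] : Poly → Poly → Carrier → Set _
  f ≡ g [mod a ] = ∀ k → a ∣ coeff (f ⊖ g) k

-- All (i₁ , … , iₙ) with l < i₁ < ⋯ < iₙ < p, each listed once.
increasing : (p n l : ℕ) → List (Vec ℕ n)
increasing p zero    l = [] ∷ []
increasing p (suc n) l =
  concatMap (λ i → map (i ∷_) (increasing p n i)) (filter (l ℕ.<?_) (upTo p))

module _ (p : ℕ) where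

  open Padic p using (ℤₚ-commutativeRing; 1/_)
  open Polynomial ℤₚ-commutativeRing

  F : (n : ℕ) .{{_ : NonZero n}} → Poly
  F (suc n) = ∑ (map (λ is → monomial (1/ product (toList is)) (head is))
                     (increasing p (suc n) 0))

{-# OPTIONS --safe #-}

-- Write Fₙ ∈ 𝔽ₚ[X] for the reduction and eₙ for the n-th elementary symmetric function of
-- 1, 1/2, … , 1/(p-1). Summing the geometric series over i₁ in the derivative gives
-- x(1 - x) Fₙ₊₁′ = eₙ x - Fₙ, and eₙ = 0 for 0 < n < p - 1, because ∏ (1 + x/i) = 1 - x^(p-1).
-- With F₀ := x^p - x this also holds, without the term eₙ x, for n = 0, and F₀(1 - x) = - F₀(x)
-- by Frobenius. If Fₙ(1 - x) = ε Fₙ(x), then Fₙ₊₁(1 - x) + ε Fₙ₊₁(x) has derivative 0 and degree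
-- less than p, so it is the constant Fₙ₊₁(1) = eₙ₊₁ = 0.
module Submission where

open import Defs
open import Algebra.Bundles using (module CommutativeRing)
open import Data.Integer using (+_)
open import Data.Nat using (ℕ; pred; NonZero; _<_; _+_)
open import Data.Nat.Primality using (Prime)
import Algebra.Properties.Semiring.Exp as Exp

open import Data.Integer as ℤ using (ℤ; 0ℤ; 1ℤ; -1ℤ)
import Data.Integer.Properties as ℤ
open import Data.Integer.Divisibility.Signed as ℤ using (divides)
open import Data.Integer.Tactic.RingSolver using (solve-∀)
open import Data.List using (List; []; _∷_; _++_; map; concatMap; filter; length; replicate; upTo; applyUpTo)
open import Data.List.Properties using (filter-++; filter-none; filter-all; length-map)
import Data.List.Relation.Unary.All as All
open import Data.List.Relation.Unary.All.Properties using (all-upTo; applyUpTo⁺₂)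
open import Data.Nat as ℕ using (zero; suc; _≤_; s≤s; z≤n; z<s; s<s; _⊔_)
import Data.Nat.Properties as ℕ
import Data.Nat.Divisibility as ℕ
open import Data.Nat.ListAction using (product)
open import Data.Nat.Coprimality using (Coprime; prime⇒coprime)
import Data.Nat.Coprimality as Coprime
open import Data.Nat.Primality using (prime⇒irreducible)
open import Data.Product using (_,_)
open import Data.Sum using (inj₂)
open import Data.Vec using (Vec; head; toList) renaming (_∷_ to _∷ᵥ_)
open import Function using (_∘_; id)
open import Relation.Binary using (tri<; tri≈; tri>; Setoid)
import Relation.Binary.Reasoning.Setoid as SetoidReasoning
open import Relation.Binary.PropositionalEquality as ≡ using (_≡_; _≢_; refl; sym; trans; cong; cong₂; subst)
open import Relation.Nullary using (¬_; yes; no; contradiction)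

-- No field 𝔽ₚ is constructed: a reduced polynomial is a list of integers, and equality in 𝔽ₚ[X] is
-- congruence modulo p of all coefficients. Division by i is multiplication by `a i`, of which only
-- i · a i ≡ 1 is assumed; since 1, ... , p - 1 are invertible, differentiation can be undone in
-- degrees 1 to p - 1. Identities in f(1 - x) are checked coefficient by coefficient through the
-- recursion `reflected`, so products of polynomials with their trailing zeros need not be compared.
-- Every polynomial of the induction, x^p - x included, has a factor x; once it is removed, the
-- differential equation modulo p reads (1 - x) Fₙ₊₁′ = - Fₙ / x, and the factor 1 - x turns into a
-- mere shift of coefficients under the substitution. Frobenius comes from derivatives instead of
-- binomial coefficients. It yields Fermat's little theorem, and that supplies the roots behind the
-- product formula. The hypothesis p > n + 1 enters through the vanishing of e₁, ... , eₙ, and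
-- through p being odd.

-- Finite sums of integers over lists.

module IntegerSums where

  ∑ᶻ : ∀ {A : Set} → (A → ℤ) → List A → ℤ
  ∑ᶻ φ []       = 0ℤ
  ∑ᶻ φ (x ∷ xs) = φ x ℤ.+ ∑ᶻ φ xs

  ∑ᶻ-cong : ∀ {A : Set} {φ ψ : A → ℤ} → (∀ x → φ x ≡ ψ x) → ∀ xs → ∑ᶻ φ xs ≡ ∑ᶻ ψ xs
  ∑ᶻ-cong h []       = refl
  ∑ᶻ-cong h (x ∷ xs) = cong₂ ℤ._+_ (h x) (∑ᶻ-cong h xs)

  ∑ᶻ-++ : ∀ {A : Set} (φ : A → ℤ) xs ys → ∑ᶻ φ (xs ++ ys) ≡ ∑ᶻ φ xs ℤ.+ ∑ᶻ φ ys
  ∑ᶻ-++ φ []       ys = sym (ℤ.+-identityˡ _)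
  ∑ᶻ-++ φ (x ∷ xs) ys = trans (cong (λ t → φ x ℤ.+ t) (∑ᶻ-++ φ xs ys)) (sym (ℤ.+-assoc (φ x) (∑ᶻ φ xs) (∑ᶻ φ ys)))

  ∑ᶻ-map : ∀ {A B : Set} (φ : B → ℤ) (g : A → B) xs → ∑ᶻ φ (map g xs) ≡ ∑ᶻ (φ ∘ g) xs
  ∑ᶻ-map φ g []       = refl
  ∑ᶻ-map φ g (x ∷ xs) = cong (λ t → φ (g x) ℤ.+ t) (∑ᶻ-map φ g xs)

  ∑ᶻ-concatMap : ∀ {A B : Set} (φ : B → ℤ) (g : A → List B) xs →
                 ∑ᶻ φ (concatMap g xs) ≡ ∑ᶻ (λ x → ∑ᶻ φ (g x)) xs
  ∑ᶻ-concatMap φ g []       = refl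
  ∑ᶻ-concatMap φ g (x ∷ xs) = trans (∑ᶻ-++ φ (g x) (concatMap g xs)) (cong (λ t → ∑ᶻ φ (g x) ℤ.+ t) (∑ᶻ-concatMap φ g xs))

-- Ranges of consecutive indices.

module Intervals where

  -- Indexed by start and length, so that with l + m = p - 1 the possible values of the next index
  -- in `increasing` can be treated by structural induction on m.
  interval : ℕ → ℕ → List ℕ
  interval l zero    = []
  interval l (suc m) = suc l ∷ interval (suc l) m

  applyUpTo-interval : ∀ (f : ℕ → ℕ) l m → (∀ i → f i ≡ suc (l + i)) → applyUpTo f m ≡ interval l m
  applyUpTo-interval f l zero    h = refl
  applyUpTo-interval f l (suc m) h = cong₂ _∷_ (trans (h 0) (cong suc (ℕ.+-identityʳ l)))
    (applyUpTo-interval (f ∘ suc) (suc l) m (λ i → trans (h (suc i)) (cong suc (ℕ.+-suc l i))))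

  applyUpTo-+ : ∀ {A : Set} (f : ℕ → A) m n → applyUpTo f (m + n) ≡ applyUpTo f m ++ applyUpTo (λ i → f (m + i)) n
  applyUpTo-+ f zero    n = refl
  applyUpTo-+ f (suc m) n = cong (f 0 ∷_) (applyUpTo-+ (f ∘ suc) m n)

  -- Split `upTo` after l: the first l + 1 entries all fail the test, the remaining m all pass it.
  filter-upTo : ∀ l m → filter (l ℕ.<?_) (upTo (suc (l + m))) ≡ interval l m
  filter-upTo l m = begin
    filter (l ℕ.<?_) (upTo (suc l + m))
      ≡⟨ cong (filter (l ℕ.<?_)) (applyUpTo-+ id (suc l) m) ⟩
    filter (l ℕ.<?_) (upTo (suc l) ++ applyUpTo (λ i → suc l + i) m)
      ≡⟨ filter-++ (l ℕ.<?_) (upTo (suc l)) _ ⟩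
    filter (l ℕ.<?_) (upTo (suc l)) ++ filter (l ℕ.<?_) (applyUpTo (λ i → suc l + i) m)
      ≡⟨ cong₂ _++_ (filter-none (l ℕ.<?_) (All.map (λ i<1+l → ℕ.≤⇒≯ (ℕ.≤-pred i<1+l)) (all-upTo (suc l))))
                    (filter-all (l ℕ.<?_) (applyUpTo⁺₂ (λ i → suc l + i) m (ℕ.m≤m+n (suc l)))) ⟩
    applyUpTo (λ i → suc l + i) m
      ≡⟨ applyUpTo-interval (λ i → suc l + i) l m (λ _ → refl) ⟩
    interval l m
      ∎
    where open ≡.≡-Reasoning

-- Polynomials with integer coefficients.

module IntegerPolynomials where

  open IntegerSums
  open Polynomial ℤ.+-*-commutativeRing public

  coeff-⊕ : ∀ f g k → coeff (f ⊕ g) k ≡ coeff f k ℤ.+ coeff g k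
  coeff-⊕ []      g       k       = sym (ℤ.+-identityˡ _)
  coeff-⊕ (a ∷ f) []      k       = sym (ℤ.+-identityʳ _)
  coeff-⊕ (a ∷ f) (b ∷ g) zero    = refl
  coeff-⊕ (a ∷ f) (b ∷ g) (suc k) = coeff-⊕ f g k

  coeff-· : ∀ a f k → coeff (a · f) k ≡ a ℤ.* coeff f k
  coeff-· a []      k       = sym (ℤ.*-zeroʳ a)
  coeff-· a (b ∷ f) zero    = refl
  coeff-· a (b ∷ f) (suc k) = coeff-· a f k

  coeff-neg : ∀ f k → coeff (map ℤ.-_ f) k ≡ ℤ.- coeff f k
  coeff-neg []      k       = refl
  coeff-neg (b ∷ f) zero    = refl
  coeff-neg (b ∷ f) (suc k) = coeff-neg f k

  coeff-beyond : ∀ f {k} → length f ≤ k → coeff f k ≡ 0ℤ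
  coeff-beyond []      _       = refl
  coeff-beyond (a ∷ f) (s≤s h) = coeff-beyond f h

  coeff-monomial-≡ : ∀ a m → coeff (monomial a m) m ≡ a
  coeff-monomial-≡ a zero    = refl
  coeff-monomial-≡ a (suc m) = coeff-monomial-≡ a m

  coeff-monomial-≢ : ∀ a {m k} → k ≢ m → coeff (monomial a m) k ≡ 0ℤ
  coeff-monomial-≢ a {zero}  {zero}  k≢m = contradiction refl k≢m
  coeff-monomial-≢ a {zero}  {suc k} k≢m = refl
  coeff-monomial-≢ a {suc m} {zero}  k≢m = refl
  coeff-monomial-≢ a {suc m} {suc k} k≢m = coeff-monomial-≢ a (k≢m ∘ cong suc)

  length-⊕ : ∀ f g → length (f ⊕ g) ≡ length f ⊔ length g
  length-⊕ []      g       = refl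
  length-⊕ (a ∷ f) []      = refl
  length-⊕ (a ∷ f) (b ∷ g) = cong suc (length-⊕ f g)

  length-monomial : ∀ a m → length (monomial a m) ≡ suc m
  length-monomial a zero    = refl
  length-monomial a (suc m) = cong suc (length-monomial a m)

  eval : Poly → ℤ → ℤ
  eval []      x = 0ℤ
  eval (a ∷ f) x = a ℤ.+ x ℤ.* eval f x

  eval-⊕ : ∀ f g x → eval (f ⊕ g) x ≡ eval f x ℤ.+ eval g x
  eval-⊕ []      g       x = sym (ℤ.+-identityˡ _)
  eval-⊕ (a ∷ f) []      x = sym (ℤ.+-identityʳ _)
  eval-⊕ (a ∷ f) (b ∷ g) x rewrite eval-⊕ f g x = ring a b x (eval f x) (eval g x)
    where
    ring : ∀ a b x u v → a ℤ.+ b ℤ.+ x ℤ.* (u ℤ.+ v) ≡ a ℤ.+ x ℤ.* u ℤ.+ (b ℤ.+ x ℤ.* v)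
    ring = solve-∀

  eval-· : ∀ a f x → eval (a · f) x ≡ a ℤ.* eval f x
  eval-· a []      x = sym (ℤ.*-zeroʳ a)
  eval-· a (b ∷ f) x rewrite eval-· a f x = ring a b x (eval f x)
    where
    ring : ∀ a b x u → a ℤ.* b ℤ.+ x ℤ.* (a ℤ.* u) ≡ a ℤ.* (b ℤ.+ x ℤ.* u)
    ring = solve-∀

  eval-⊗ : ∀ f g x → eval (f ⊗ g) x ≡ eval f x ℤ.* eval g x
  eval-⊗ []      g x = refl
  eval-⊗ (a ∷ f) g x
    rewrite eval-⊕ (a · g) (0ℤ ∷ f ⊗ g) x | eval-· a g x | eval-⊗ f g x
    = ring a x (eval f x) (eval g x)
    where
    ring : ∀ a x u v → a ℤ.* v ℤ.+ (0ℤ ℤ.+ x ℤ.* (u ℤ.* v)) ≡ (a ℤ.+ x ℤ.* u) ℤ.* v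
    ring = solve-∀

  eval-⟨⟩ : ∀ f g x → eval (f ⟨ g ⟩) x ≡ eval f (eval g x)
  eval-⟨⟩ []      g x = refl
  eval-⟨⟩ (a ∷ f) g x
    rewrite eval-⊕ (constant a) (g ⊗ f ⟨ g ⟩) x | eval-⊗ g (f ⟨ g ⟩) x | eval-⟨⟩ f g x
          | ℤ.*-zeroʳ x | ℤ.+-identityʳ a
    = refl

  eval-monomial : ∀ a m x → eval (monomial a m) x ≡ a ℤ.* x ℤ.^ m
  eval-monomial a zero    x = ring a x
    where
    ring : ∀ a x → a ℤ.+ x ℤ.* 0ℤ ≡ a ℤ.* 1ℤ
    ring = solve-∀
  eval-monomial a (suc m) x rewrite eval-monomial a m x = ring a x (x ℤ.^ m)
    where
    ring : ∀ a x t → 0ℤ ℤ.+ x ℤ.* (a ℤ.* t) ≡ a ℤ.* (x ℤ.* t)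
    ring = solve-∀

  -- Substitution of 1 - x.

  1-X : Poly
  1-X = constant 1ℤ ⊖ X

  -- Coefficients of f(1 - X) by Horner's rule: a + X f becomes a + (1 - X) f(1 - X). The value at
  -- index 0 is f(1), the sum of all coefficients.
  reflected : Poly → ℕ → ℤ
  reflected []      k       = 0ℤ
  reflected (a ∷ f) zero    = a ℤ.+ reflected f 0
  reflected (a ∷ f) (suc k) = reflected f (suc k) ℤ.- reflected f k

  coeff-constant-0 : ∀ k → coeff (0ℤ ∷ []) k ≡ 0ℤ
  coeff-constant-0 zero    = refl
  coeff-constant-0 (suc k) = refl

  coeff-⟨1-X⟩ : ∀ f k → coeff (f ⟨ 1-X ⟩) k ≡ reflected f k
  coeff-⟨1-X⟩ []      k    = refl
  -- `1-X ⊗ g` unfolds to `1ℤ · g ⊕ (0ℤ ∷ (-1ℤ · g ⊕ (0ℤ ∷ [])))`; the last summand is the trailing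
  -- zero left by `⊗`.
  coeff-⟨1-X⟩ (a ∷ f) zero
    rewrite coeff-⊕ (constant a) (1-X ⊗ f ⟨ 1-X ⟩) 0
          | coeff-⊕ (1ℤ · f ⟨ 1-X ⟩) (0ℤ ∷ (-1ℤ · f ⟨ 1-X ⟩ ⊕ (0ℤ ∷ []))) 0
          | coeff-· 1ℤ (f ⟨ 1-X ⟩) 0
          | coeff-⟨1-X⟩ f 0
    = ring a (reflected f 0)
    where
    ring : ∀ a u → a ℤ.+ (1ℤ ℤ.* u ℤ.+ 0ℤ) ≡ a ℤ.+ u
    ring = solve-∀
  coeff-⟨1-X⟩ (a ∷ f) (suc k)
    rewrite coeff-⊕ (constant a) (1-X ⊗ f ⟨ 1-X ⟩) (suc k)
          | coeff-⊕ (1ℤ · f ⟨ 1-X ⟩) (0ℤ ∷ (-1ℤ · f ⟨ 1-X ⟩ ⊕ (0ℤ ∷ []))) (suc k)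
          | coeff-⊕ (-1ℤ · f ⟨ 1-X ⟩) (0ℤ ∷ []) k
          | coeff-· 1ℤ (f ⟨ 1-X ⟩) (suc k)
          | coeff-· -1ℤ (f ⟨ 1-X ⟩) k
          | coeff-⟨1-X⟩ f (suc k)
          | coeff-⟨1-X⟩ f k
          | coeff-constant-0 k
    = ring (reflected f (suc k)) (reflected f k)
    where
    ring : ∀ u v → 0ℤ ℤ.+ (1ℤ ℤ.* u ℤ.+ (-1ℤ ℤ.* v ℤ.+ 0ℤ)) ≡ u ℤ.- v
    ring = solve-∀

  reflected-⊕ : ∀ f g k → reflected (f ⊕ g) k ≡ reflected f k ℤ.+ reflected g k
  reflected-⊕ []      g  k = sym (ℤ.+-identityˡ _)
  reflected-⊕ (a ∷ f) [] k = sym (ℤ.+-identityʳ _)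
  reflected-⊕ (a ∷ f) (b ∷ g) zero rewrite reflected-⊕ f g 0 =
    ring a b (reflected f 0) (reflected g 0)
    where
    ring : ∀ a b u v → a ℤ.+ b ℤ.+ (u ℤ.+ v) ≡ a ℤ.+ u ℤ.+ (b ℤ.+ v)
    ring = solve-∀
  reflected-⊕ (a ∷ f) (b ∷ g) (suc k) rewrite reflected-⊕ f g (suc k) | reflected-⊕ f g k =
    ring (reflected f (suc k)) (reflected g (suc k)) (reflected f k) (reflected g k)
    where
    ring : ∀ u v u′ v′ → u ℤ.+ v ℤ.- (u′ ℤ.+ v′) ≡ u ℤ.- u′ ℤ.+ (v ℤ.- v′)
    ring = solve-∀

  reflected-neg : ∀ f k → reflected (map ℤ.-_ f) k ≡ ℤ.- reflected f k
  reflected-neg []      k       = refl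
  reflected-neg (a ∷ f) zero    rewrite reflected-neg f 0 = sym (ℤ.neg-distrib-+ a (reflected f 0))
  reflected-neg (a ∷ f) (suc k) rewrite reflected-neg f (suc k) | reflected-neg f k =
    sym (ℤ.neg-distrib-+ (reflected f (suc k)) (ℤ.- reflected f k))

  -- Since 1 - x has degree 1, the substitution does not raise the degree.
  reflected-beyond : ∀ f {k} → length f ≤ k → reflected f k ≡ 0ℤ
  reflected-beyond []      _       = refl
  reflected-beyond (a ∷ f) (s≤s h)
    rewrite reflected-beyond f h | reflected-beyond f (ℕ.m≤n⇒m≤1+n h) = refl

  reflected-monomial-constant : ∀ m → reflected (monomial 1ℤ m) 0 ≡ 1ℤ
  reflected-monomial-constant zero    = refl
  reflected-monomial-constant (suc m) rewrite reflected-monomial-constant m = refl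

  reflected-monomial-leading : ∀ m → reflected (monomial 1ℤ m) m ≡ -1ℤ ℤ.^ m
  reflected-monomial-leading zero    = refl
  reflected-monomial-leading (suc m)
    rewrite reflected-beyond (monomial 1ℤ m) (ℕ.≤-reflexive (length-monomial 1ℤ m))
          | reflected-monomial-leading m
    = trans (ℤ.+-identityˡ _) (sym (ℤ.-1*i≡-i (-1ℤ ℤ.^ m)))

  -- Formal derivatives and multiplication by 1 - X.

  -- The product rule (a + X f)′ = f + X f′, which needs no counter for the degree.
  D : Poly → Poly
  D []      = []
  D (a ∷ f) = f ⊕ (0ℤ ∷ D f)

  coeff-D : ∀ f k → coeff (D f) k ≡ + suc k ℤ.* coeff f (suc k)
  coeff-D []      k    = sym (ℤ.*-zeroʳ (+ suc k))
  coeff-D (a ∷ f) zero rewrite coeff-⊕ f (0ℤ ∷ D f) 0 = ring (coeff f 0)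
    where
    ring : ∀ u → u ℤ.+ 0ℤ ≡ 1ℤ ℤ.* u
    ring = solve-∀
  coeff-D (a ∷ f) (suc k) rewrite coeff-⊕ f (0ℤ ∷ D f) (suc k) | coeff-D f k =
    ring (+ suc k) (coeff f (suc k))
    where
    ring : ∀ n u → u ℤ.+ n ℤ.* u ≡ (1ℤ ℤ.+ n) ℤ.* u
    ring = solve-∀

  -- The chain rule for f(1 - x).
  reflected-D : ∀ f k → + suc k ℤ.* reflected f (suc k) ≡ ℤ.- reflected (D f) k
  reflected-D []      k    = ℤ.*-zeroʳ (+ suc k)
  reflected-D (a ∷ f) zero rewrite reflected-⊕ f (0ℤ ∷ D f) 0 = begin
    1ℤ ℤ.* (u₁ ℤ.- u₀)              ≡⟨ ring₁ u₁ u₀ ⟩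
    1ℤ ℤ.* u₁ ℤ.- u₀                ≡⟨ cong (ℤ._- u₀) (reflected-D f 0) ⟩
    ℤ.- v ℤ.- u₀                    ≡⟨ ring₂ u₀ v ⟩
    ℤ.- (u₀ ℤ.+ (0ℤ ℤ.+ v))         ∎
    where
    open ≡.≡-Reasoning
    u₁ = reflected f 1
    u₀ = reflected f 0
    v  = reflected (D f) 0
    ring₁ : ∀ u₁ u₀ → 1ℤ ℤ.* (u₁ ℤ.- u₀) ≡ 1ℤ ℤ.* u₁ ℤ.- u₀
    ring₁ = solve-∀
    ring₂ : ∀ u v → ℤ.- v ℤ.- u ≡ ℤ.- (u ℤ.+ (0ℤ ℤ.+ v))
    ring₂ = solve-∀
  reflected-D (a ∷ f) (suc k) rewrite reflected-⊕ f (0ℤ ∷ D f) (suc k) = begin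
    + suc (suc k) ℤ.* (u₂ ℤ.- u₁)                            ≡⟨ ring₁ (+ suc k) u₂ u₁ ⟩
    (1ℤ ℤ.+ + suc k) ℤ.* u₂ ℤ.- + suc k ℤ.* u₁ ℤ.- u₁       
      ≡⟨ cong₂ (λ s t → s ℤ.- t ℤ.- u₁) (reflected-D f (suc k)) (reflected-D f k) ⟩
    ℤ.- v₁ ℤ.- ℤ.- v₀ ℤ.- u₁                                 ≡⟨ ring₂ u₁ v₁ v₀ ⟩
    ℤ.- (u₁ ℤ.+ (v₁ ℤ.- v₀))                                 ∎
    where
    open ≡.≡-Reasoning
    u₂ = reflected f (suc (suc k))
    u₁ = reflected f (suc k)
    v₁ = reflected (D f) (suc k)
    v₀ = reflected (D f) k
    ring₁ : ∀ n u₂ u₁ → (1ℤ ℤ.+ n) ℤ.* (u₂ ℤ.- u₁) ≡ (1ℤ ℤ.+ n) ℤ.* u₂ ℤ.- n ℤ.* u₁ ℤ.- u₁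
    ring₁ = solve-∀
    ring₂ : ∀ u v₁ v₀ → ℤ.- v₁ ℤ.- ℤ.- v₀ ℤ.- u ≡ ℤ.- (u ℤ.+ (v₁ ℤ.- v₀))
    ring₂ = solve-∀

  infix 8 1-X∙_
  1-X∙_ : Poly → Poly
  1-X∙ f = f ⊖ (0ℤ ∷ f)

  coeff-1-X∙-zero : ∀ f → coeff (1-X∙ f) 0 ≡ coeff f 0
  coeff-1-X∙-zero f rewrite coeff-⊕ f (map ℤ.-_ (0ℤ ∷ f)) 0 = ℤ.+-identityʳ _

  coeff-1-X∙-suc : ∀ f k → coeff (1-X∙ f) (suc k) ≡ coeff f (suc k) ℤ.- coeff f k
  coeff-1-X∙-suc f k rewrite coeff-⊕ f (map ℤ.-_ (0ℤ ∷ f)) (suc k) | coeff-neg f k = refl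

  -- The substitution turns the factor 1 - X into X, so the result is f(1 - X) shifted by one place:
  -- no constant term here, the other coefficients in the next lemma.
  reflected-1-X∙-zero : ∀ f → reflected (1-X∙ f) 0 ≡ 0ℤ
  reflected-1-X∙-zero f
    rewrite reflected-⊕ f (map ℤ.-_ (0ℤ ∷ f)) 0 | reflected-neg f 0
    = ring (reflected f 0)
    where
    ring : ∀ u → u ℤ.+ (0ℤ ℤ.+ ℤ.- u) ≡ 0ℤ
    ring = solve-∀

  reflected-1-X∙-suc : ∀ f k → reflected (1-X∙ f) (suc k) ≡ reflected f k
  reflected-1-X∙-suc f k
    rewrite reflected-⊕ f (map ℤ.-_ (0ℤ ∷ f)) (suc k) | reflected-neg f k | reflected-neg f (suc k)
    = ring (reflected f (suc k)) (reflected f k)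
    where
    ring : ∀ u v → u ℤ.+ (ℤ.- u ℤ.- ℤ.- v) ≡ v
    ring = solve-∀

  neg-^-odd : ∀ x m → ¬ 2 ℕ.∣ m → (ℤ.- x) ℤ.^ m ≡ ℤ.- (x ℤ.^ m)
  neg-^-odd x zero          odd = contradiction (2 ℕ.∣0) odd
  neg-^-odd x (suc zero)    odd = ring x
    where
    ring : ∀ x → ℤ.- x ℤ.* 1ℤ ≡ ℤ.- (x ℤ.* 1ℤ)
    ring = solve-∀
  neg-^-odd x (suc (suc m)) odd
    rewrite neg-^-odd x m (odd ∘ ℕ.∣m∣n⇒∣m+n ℕ.∣-refl) = ring x (x ℤ.^ m)
    where
    ring : ∀ x t → ℤ.- x ℤ.* (ℤ.- x ℤ.* ℤ.- t) ≡ ℤ.- (x ℤ.* (x ℤ.* t))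
    ring = solve-∀

  -- Division by a linear factor.

  -- Synthetic division: this is (f - f(r)) / (X - r), whose coefficients are the values at r of the
  -- successive proper tails of f.
  quotient : ℤ → Poly → Poly
  quotient r []          = []
  quotient r (c ∷ [])    = []
  quotient r (c ∷ d ∷ f) = eval (d ∷ f) r ∷ quotient r (d ∷ f)

  length-quotient : ∀ r c f → length (quotient r (c ∷ f)) ≡ length f
  length-quotient r c []      = refl
  length-quotient r c (d ∷ f) = cong suc (length-quotient r d f)

  eval-quotient : ∀ r f x → eval f x ≡ eval f r ℤ.+ (x ℤ.- r) ℤ.* eval (quotient r f) x
  eval-quotient r []       x = ring x r
    where
    ring : ∀ x r → 0ℤ ≡ 0ℤ ℤ.+ (x ℤ.- r) ℤ.* 0ℤ
    ring = solve-∀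
  eval-quotient r (c ∷ []) x = ring c x r
    where
    ring : ∀ c x r → c ℤ.+ x ℤ.* 0ℤ ≡ c ℤ.+ r ℤ.* 0ℤ ℤ.+ (x ℤ.- r) ℤ.* 0ℤ
    ring = solve-∀
  eval-quotient r (c ∷ f@(_ ∷ _)) x = begin
    c ℤ.+ x ℤ.* eval f x
      ≡⟨ cong (λ t → c ℤ.+ x ℤ.* t) (eval-quotient r f x) ⟩
    c ℤ.+ x ℤ.* (eval f r ℤ.+ (x ℤ.- r) ℤ.* eval (quotient r f) x)
      ≡⟨ ring c x r (eval f r) (eval (quotient r f) x) ⟩
    c ℤ.+ r ℤ.* eval f r ℤ.+ (x ℤ.- r) ℤ.* (eval f r ℤ.+ x ℤ.* eval (quotient r f) x)
      ∎
    where
    open ≡.≡-Reasoning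
    ring : ∀ c x r u w → c ℤ.+ x ℤ.* (u ℤ.+ (x ℤ.- r) ℤ.* w)
                       ≡ c ℤ.+ r ℤ.* u ℤ.+ (x ℤ.- r) ℤ.* (u ℤ.+ x ℤ.* w)
    ring = solve-∀

  -- Coefficients of sums of monomials.

  coeff-∑ : ∀ {A : Set} (g : A → Poly) xs k → coeff (∑ (map g xs)) k ≡ ∑ᶻ (λ x → coeff (g x) k) xs
  coeff-∑ g []       k = refl
  coeff-∑ g (x ∷ xs) k = trans (coeff-⊕ (g x) (∑ (map g xs)) k) (cong (λ t → coeff (g x) k ℤ.+ t) (coeff-∑ g xs k))

  -- Gathers the contributions of all tuples with the same first index i into a single monomial.
  coeff-monomial-∑ᶻ : ∀ {A : Set} (φ : A → ℤ) i k xs →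
    ∑ᶻ (λ x → coeff (monomial (φ x) i) k) xs ≡ coeff (monomial (∑ᶻ φ xs) i) k
  coeff-monomial-∑ᶻ φ i k []       = sym (zero-monomial i k)
    where
    zero-monomial : ∀ i k → coeff (monomial 0ℤ i) k ≡ 0ℤ
    zero-monomial zero    k       = coeff-constant-0 k
    zero-monomial (suc i) zero    = refl
    zero-monomial (suc i) (suc k) = zero-monomial i k
  coeff-monomial-∑ᶻ φ i k (x ∷ xs) =
    trans (cong (λ t → coeff (monomial (φ x) i) k ℤ.+ t) (coeff-monomial-∑ᶻ φ i k xs)) (additive i k)
    where
    additive : ∀ i k → coeff (monomial (φ x) i) k ℤ.+ coeff (monomial (∑ᶻ φ xs) i) k
                     ≡ coeff (monomial (φ x ℤ.+ ∑ᶻ φ xs) i) k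
    additive zero    zero    = refl
    additive zero    (suc k) = refl
    additive (suc i) zero    = refl
    additive (suc i) (suc k) = additive i k

  shift : ℕ → Poly → Poly
  shift i f = replicate i 0ℤ ++ f

  coeff-shift-∷ : ∀ v f i k → coeff (monomial v i) k ℤ.+ coeff (shift (suc i) f) k ≡ coeff (shift i (v ∷ f)) k
  coeff-shift-∷ v f zero    zero    = ℤ.+-identityʳ v
  coeff-shift-∷ v f zero    (suc k) = ℤ.+-identityˡ _
  coeff-shift-∷ v f (suc i) zero    = refl
  coeff-shift-∷ v f (suc i) (suc k) = coeff-shift-∷ v f i k

-- A common divisor d of m n and o is coprime to m, because its divisors divide o; hence d divides
-- n, and so d = 1.
coprime-* : ∀ {m n o} → Coprime m o → Coprime n o → Coprime (m ℕ.* n) o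
coprime-* m⊥o n⊥o (d∣mn , d∣o) =
  n⊥o (Coprime.coprime-divisor (λ (x∣d , x∣m) → m⊥o (x∣m , ℕ.∣-trans x∣d d∣o)) d∣mn , d∣o)

-- Congruence modulo p.

module Congruence (p : ℕ) where

  open IntegerPolynomials

  infix 4 _≈_
  -- A record, so that x and y can be inferred from the type; they cannot be recovered from their
  -- difference.
  record _≈_ (x y : ℤ) : Set where
    constructor mk≈
    field
      divisible : + p ℤ.∣ x ℤ.- y
  open _≈_ public

  private
    along : ∀ {x y} → x ≡ y → + p ℤ.∣ x → + p ℤ.∣ y
    along = subst (+ p ℤ.∣_)

  ≈-reflexive : ∀ {x y} → x ≡ y → x ≈ y
  ≈-reflexive {x} refl = mk≈ (divides 0ℤ (ℤ.+-inverseʳ x))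

  ≈-refl : ∀ {x} → x ≈ x
  ≈-refl = ≈-reflexive refl

  ≈-sym : ∀ {x y} → x ≈ y → y ≈ x
  ≈-sym {x} {y} (mk≈ d) = mk≈ (along (ring x y) (ℤ.∣m⇒∣-m d))
    where
    ring : ∀ x y → ℤ.- (x ℤ.- y) ≡ y ℤ.- x
    ring = solve-∀

  ≈-trans : ∀ {x y z} → x ≈ y → y ≈ z → x ≈ z
  ≈-trans {x} {y} {z} (mk≈ d) (mk≈ e) = mk≈ (along (ring x y z) (ℤ.∣m∣n⇒∣m+n d e))
    where
    ring : ∀ x y z → x ℤ.- y ℤ.+ (y ℤ.- z) ≡ x ℤ.- z
    ring = solve-∀

  +-cong : ∀ {x y u v} → x ≈ y → u ≈ v → x ℤ.+ u ≈ y ℤ.+ v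
  +-cong {x} {y} {u} {v} (mk≈ d) (mk≈ e) = mk≈ (along (ring x y u v) (ℤ.∣m∣n⇒∣m+n d e))
    where
    ring : ∀ x y u v → x ℤ.- y ℤ.+ (u ℤ.- v) ≡ x ℤ.+ u ℤ.- (y ℤ.+ v)
    ring = solve-∀

  *-cong : ∀ {x y u v} → x ≈ y → u ≈ v → x ℤ.* u ≈ y ℤ.* v
  *-cong {x} {y} {u} {v} (mk≈ d) (mk≈ e) =
    mk≈ (along (ring x y u v) (ℤ.∣m∣n⇒∣m+n (ℤ.∣m⇒∣m*n u d) (ℤ.∣n⇒∣m*n y e)))
    where
    ring : ∀ x y u v → (x ℤ.- y) ℤ.* u ℤ.+ y ℤ.* (u ℤ.- v) ≡ x ℤ.* u ℤ.- y ℤ.* v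
    ring = solve-∀

  neg-cong : ∀ {x y} → x ≈ y → ℤ.- x ≈ ℤ.- y
  neg-cong {x} {y} (mk≈ d) = mk≈ (along (ring x y) (ℤ.∣m⇒∣-m d))
    where
    ring : ∀ x y → ℤ.- (x ℤ.- y) ≡ ℤ.- x ℤ.- ℤ.- y
    ring = solve-∀

  +-congˡ : ∀ x {u v} → u ≈ v → x ℤ.+ u ≈ x ℤ.+ v
  +-congˡ x = +-cong (≈-refl {x})

  -‿cong : ∀ {x y u v} → x ≈ y → u ≈ v → x ℤ.- u ≈ y ℤ.- v
  -‿cong d e = +-cong d (neg-cong e)

  *-congˡ : ∀ x {u v} → u ≈ v → x ℤ.* u ≈ x ℤ.* v
  *-congˡ x = *-cong (≈-refl {x})

  *-zeroʳ-≈ : ∀ x {u} → u ≈ 0ℤ → x ℤ.* u ≈ 0ℤ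
  *-zeroʳ-≈ x u≈0 = ≈-trans (*-congˡ x u≈0) (≈-reflexive (ℤ.*-zeroʳ x))

  p≈0 : + p ≈ 0ℤ
  p≈0 = mk≈ (along (sym (ℤ.+-identityʳ (+ p))) ℤ.∣-refl)

  ≈-setoid : Setoid _ _
  ≈-setoid = record
    { Carrier = ℤ
    ; _≈_ = _≈_
    ; isEquivalence = record { refl = ≈-refl ; sym = ≈-sym ; trans = ≈-trans }
    }

  module ≈-Reasoning = SetoidReasoning ≈-setoid

  coeff-monomial-cong : ∀ {x y} → x ≈ y → ∀ i k → coeff (monomial x i) k ≈ coeff (monomial y i) k
  coeff-monomial-cong h zero    zero    = h
  coeff-monomial-cong h zero    (suc k) = ≈-refl
  coeff-monomial-cong h (suc i) zero    = ≈-refl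
  coeff-monomial-cong h (suc i) (suc k) = coeff-monomial-cong h i k

  -- Lists with congruent coefficients may differ in length; the shorter one is continued by zeros,
  -- which gives the mixed cases.
  reflected-cong : ∀ f g → (∀ k → coeff f k ≈ coeff g k) → ∀ k → reflected f k ≈ reflected g k
  reflected-cong []      []      h k       = ≈-refl
  reflected-cong []      (b ∷ g) h zero    = +-cong (h 0) (reflected-cong [] g (h ∘ suc) 0)
  reflected-cong []      (b ∷ g) h (suc k) =
    -‿cong (reflected-cong [] g (h ∘ suc) (suc k)) (reflected-cong [] g (h ∘ suc) k)
  reflected-cong (a ∷ f) []      h zero    = +-cong (h 0) (reflected-cong f [] (h ∘ suc) 0)
  reflected-cong (a ∷ f) []      h (suc k) =
    -‿cong (reflected-cong f [] (h ∘ suc) (suc k)) (reflected-cong f [] (h ∘ suc) k)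
  reflected-cong (a ∷ f) (b ∷ g) h zero    = +-cong (h 0) (reflected-cong f g (h ∘ suc) 0)
  reflected-cong (a ∷ f) (b ∷ g) h (suc k) =
    -‿cong (reflected-cong f g (h ∘ suc) (suc k)) (reflected-cong f g (h ∘ suc) k)

  eval-cong : ∀ f g → (∀ k → coeff f k ≈ coeff g k) → ∀ x → eval f x ≈ eval g x
  eval-cong []      []      h x = ≈-refl
  eval-cong []      (b ∷ g) h x =
    ≈-trans (≈-reflexive (sym (trans (ℤ.+-identityˡ _) (ℤ.*-zeroʳ x))))
            (+-cong (h 0) (*-congˡ x (eval-cong [] g (h ∘ suc) x)))
  eval-cong (a ∷ f) []      h x =
    ≈-trans (+-cong (h 0) (*-congˡ x (eval-cong f [] (h ∘ suc) x)))
            (≈-reflexive (trans (ℤ.+-identityˡ _) (ℤ.*-zeroʳ x)))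
  eval-cong (a ∷ f) (b ∷ g) h x = +-cong (h 0) (*-congˡ x (eval-cong f g (h ∘ suc) x))

  -- The coefficients of the quotient are values of tails at r, so r is a root of every tail modulo
  -- p. Each c is then the difference of two vanishing terms.
  quotient-zero : ∀ r f → eval f r ≈ 0ℤ → (∀ k → coeff (quotient r f) k ≈ 0ℤ) → ∀ k → coeff f k ≈ 0ℤ
  quotient-zero r []              root h k       = ≈-refl
  quotient-zero r (c ∷ [])        root h zero    =
    ≈-trans (≈-reflexive (sym (trans (cong (λ t → c ℤ.+ t) (ℤ.*-zeroʳ r)) (ℤ.+-identityʳ c)))) root
  quotient-zero r (c ∷ [])        root h (suc k) = ≈-refl
  quotient-zero r (c ∷ f@(_ ∷ _)) root h zero    = begin
    c                                                ≡⟨ ring c (r ℤ.* eval f r) ⟩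
    c ℤ.+ r ℤ.* eval f r ℤ.- r ℤ.* eval f r          ≈⟨ -‿cong root (*-zeroʳ-≈ r (h 0)) ⟩
    0ℤ                                               ∎
    where
    open ≈-Reasoning
    ring : ∀ c t → c ≡ c ℤ.+ t ℤ.- t
    ring = solve-∀
  quotient-zero r (c ∷ f@(_ ∷ _)) root h (suc k) = quotient-zero r f (h 0) (h ∘ suc) k

  -- X(1 - X) is invariant under x ↦ 1 - x, so f′ = - X g / (X(1 - X)) inherits the symmetry of X g.
  reflected-derivative : ∀ f g ε →
    (∀ k → coeff (1-X∙ D f) k ≈ ℤ.- coeff g k) →
    (∀ k → reflected (0ℤ ∷ g) k ≈ ε ℤ.* coeff (0ℤ ∷ g) k) →
    ∀ k → reflected (D f) k ≈ ε ℤ.* coeff (D f) k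
  reflected-derivative f g ε ode symmetric k = begin
    u k                   ≡⟨ reflected-1-X∙-suc (D f) k ⟨
    reflected (1-X∙ D f) (suc k) ≈⟨ reflected-ode (suc k) ⟩
    ℤ.- v (suc k)         ≈⟨ integrate k ⟩
    ε ℤ.* coeff (D f) k   ∎
    where
    open ≈-Reasoning
    u = reflected (D f)
    v = reflected g

    reflected-ode : ∀ k → reflected (1-X∙ D f) k ≈ ℤ.- v k
    reflected-ode k = ≈-trans
      (reflected-cong (1-X∙ D f) (map ℤ.-_ g)
        (λ j → ≈-trans (ode j) (≈-reflexive (sym (coeff-neg g j)))) k)
      (≈-reflexive (reflected-neg g k))

    -- After the substitution the left side of the equation is x f′(1 - x), which has no constant
    -- term.
    v₀≈0 : ℤ.- v 0 ≈ 0ℤ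
    v₀≈0 = ≈-trans (≈-sym (reflected-ode 0)) (≈-reflexive (reflected-1-X∙-zero (D f)))

    telescope : ∀ x y → ℤ.- x ≡ ℤ.- (x ℤ.- y) ℤ.+ ℤ.- y
    telescope = solve-∀

    pull-out : ∀ ε x y → ℤ.- (ε ℤ.* x) ℤ.+ y ≡ ε ℤ.* (ℤ.- x) ℤ.+ y
    pull-out = solve-∀

    -- Coefficient k + 1 of the symmetry of X g: there `reflected (0ℤ ∷ g)` is the difference of two
    -- consecutive values of `v`.
    step : ∀ k → ℤ.- v (suc k) ≈ ε ℤ.* coeff (1-X∙ D f) k ℤ.+ ℤ.- v k
    step k = begin
      ℤ.- v (suc k)                              ≡⟨ telescope (v (suc k)) (v k) ⟩
      ℤ.- (v (suc k) ℤ.- v k) ℤ.+ ℤ.- v k        ≈⟨ +-cong (neg-cong (symmetric (suc k))) ≈-refl ⟩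
      ℤ.- (ε ℤ.* coeff g k) ℤ.+ ℤ.- v k          ≡⟨ pull-out ε (coeff g k) (ℤ.- v k) ⟩
      ε ℤ.* (ℤ.- coeff g k) ℤ.+ ℤ.- v k          ≈⟨ +-cong (*-congˡ ε (ode k)) ≈-refl ⟨
      ε ℤ.* coeff (1-X∙ D f) k ℤ.+ ℤ.- v k       ∎

    -- Division by 1 - X: the partial sums of the coefficients of (1 - X) f′ are the coefficients of
    -- f′, and `v₀≈0` starts the summation.
    integrate : ∀ k → ℤ.- v (suc k) ≈ ε ℤ.* coeff (D f) k
    integrate zero = begin
      ℤ.- v 1                                    ≈⟨ step 0 ⟩
      ε ℤ.* coeff (1-X∙ D f) 0 ℤ.+ ℤ.- v 0       ≈⟨ +-congˡ (ε ℤ.* coeff (1-X∙ D f) 0) v₀≈0 ⟩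
      ε ℤ.* coeff (1-X∙ D f) 0 ℤ.+ 0ℤ            ≡⟨ ℤ.+-identityʳ _ ⟩
      ε ℤ.* coeff (1-X∙ D f) 0                   ≡⟨ cong (ε ℤ.*_) (coeff-1-X∙-zero (D f)) ⟩
      ε ℤ.* coeff (D f) 0                        ∎
    integrate (suc k) = begin
      ℤ.- v (suc (suc k))
        ≈⟨ step (suc k) ⟩
      ε ℤ.* coeff (1-X∙ D f) (suc k) ℤ.+ ℤ.- v (suc k)
        ≈⟨ +-cong (≈-reflexive (cong (ε ℤ.*_) (coeff-1-X∙-suc (D f) k))) (integrate k) ⟩
      ε ℤ.* (coeff (D f) (suc k) ℤ.- coeff (D f) k) ℤ.+ ε ℤ.* coeff (D f) k
        ≡⟨ cancel-term ε (coeff (D f) (suc k)) (coeff (D f) k) ⟩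
      ε ℤ.* coeff (D f) (suc k)
        ∎
      where
      cancel-term : ∀ ε x y → ε ℤ.* (x ℤ.- y) ℤ.+ ε ℤ.* y ≡ ε ℤ.* x
      cancel-term = solve-∀

-- Inverses modulo p.

module Reciprocals
  (q : ℕ) (p-prime : Prime (suc q)) (odd : ¬ 2 ℕ.∣ suc q) (a : ℕ → ℤ)
  (reciprocal : ∀ {i} → Coprime i (suc q) → Congruence._≈_ (suc q) (+ i ℤ.* a i) 1ℤ)
  where

  open IntegerSums
  open Intervals
  open IntegerPolynomials
  open Congruence (suc q)

  private
    p : ℕ
    p = suc q

  small-coprime : ∀ {i} → 0 < i → i < p → Coprime i p
  small-coprime 0<i i<p = Coprime.sym (prime⇒coprime p-prime {{ℕ.>-nonZero 0<i}} i<p)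

  reciprocal-< : ∀ {i} → 0 < i → i < p → + i ℤ.* a i ≈ 1ℤ
  reciprocal-< 0<i i<p = reciprocal (small-coprime 0<i i<p)

  cancel-coprime : ∀ {i} → Coprime i p → ∀ {x y} → + i ℤ.* x ≈ + i ℤ.* y → x ≈ y
  cancel-coprime {i} i⊥p {x} {y} h = begin
    x                        ≡⟨ ℤ.*-identityˡ x ⟨
    1ℤ ℤ.* x                 ≈⟨ *-cong (reciprocal i⊥p) ≈-refl ⟨
    + i ℤ.* a i ℤ.* x        ≡⟨ ring (+ i) (a i) x ⟩
    a i ℤ.* (+ i ℤ.* x)      ≈⟨ *-congˡ (a i) h ⟩
    a i ℤ.* (+ i ℤ.* y)      ≡⟨ ring (+ i) (a i) y ⟨
    + i ℤ.* a i ℤ.* y        ≈⟨ *-cong (reciprocal i⊥p) ≈-refl ⟩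
    1ℤ ℤ.* y                 ≡⟨ ℤ.*-identityˡ y ⟩
    y                        ∎
    where
    open ≈-Reasoning
    ring : ∀ i a x → i ℤ.* a ℤ.* x ≡ a ℤ.* (i ℤ.* x)
    ring = solve-∀

  cancel : ∀ {i} → 0 < i → i < p → ∀ {x y} → + i ℤ.* x ≈ + i ℤ.* y → x ≈ y
  cancel 0<i i<p = cancel-coprime (small-coprime 0<i i<p)

  cancel-0 : ∀ {i} → 0 < i → i < p → ∀ {x} → + i ℤ.* x ≈ 0ℤ → x ≈ 0ℤ
  cancel-0 {i} 0<i i<p h = cancel 0<i i<p (≈-trans h (≈-reflexive (sym (ℤ.*-zeroʳ (+ i)))))

  -- Frobenius and Fermat's little theorem.

  -- Frobenius, via the vanishing of the derivative of (1 - x)^p.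
  reflected-X^p : ∀ k → reflected (monomial 1ℤ p) k ≈ coeff (1ℤ ∷ monomial -1ℤ q) k
  reflected-X^p zero    = ≈-reflexive (reflected-monomial-constant p)
  reflected-X^p (suc k) with ℕ.<-cmp k q
  ... | tri> _ _ q<k = ≈-reflexive (trans
    (reflected-beyond (monomial 1ℤ p) (subst (_≤ suc k) (sym (length-monomial 1ℤ p)) (s≤s q<k)))
    (sym (coeff-beyond (monomial -1ℤ q) (subst (_≤ k) (sym (length-monomial -1ℤ q)) q<k))))
  -- The leading coefficient is (-1)^p, which is -1 because p is odd.
  ... | tri≈ _ refl _ = ≈-reflexive (trans
    (reflected-monomial-leading p)
    (trans (trans (neg-^-odd 1ℤ p odd) (cong ℤ.-_ (ℤ.^-zeroˡ p)))
           (sym (coeff-monomial-≡ -1ℤ q))))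
  -- Here 0 < k + 1 < p, so the factor k + 1 produced by differentiation can be cancelled.
  ... | tri< k<q k≢q _ = ≈-trans
    (cancel-0 z<s (s<s k<q) (begin
      + suc k ℤ.* reflected (monomial 1ℤ p) (suc k)  ≡⟨ reflected-D (monomial 1ℤ p) k ⟩
      ℤ.- reflected (D (monomial 1ℤ p)) k            ≈⟨ neg-cong (reflected-cong (D (monomial 1ℤ p)) [] D≈0 k) ⟩
      0ℤ                                             ∎))
    (≈-reflexive (sym (coeff-monomial-≢ -1ℤ k≢q)))
    where
    open ≈-Reasoning
    D≈0 : ∀ j → coeff (D (monomial 1ℤ p)) j ≈ 0ℤ
    D≈0 j with j ℕ.≟ q
    ... | yes refl = begin
      coeff (D (monomial 1ℤ p)) q          ≡⟨ coeff-D (monomial 1ℤ p) q ⟩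
      + p ℤ.* coeff (monomial 1ℤ q) q      ≈⟨ *-cong p≈0 ≈-refl ⟩
      0ℤ                                   ∎
    ... | no j≢q = ≈-reflexive (trans (coeff-D (monomial 1ℤ p) j)
      (trans (cong (+ suc j ℤ.*_) (coeff-monomial-≢ 1ℤ j≢q)) (ℤ.*-zeroʳ (+ suc j))))

  frobenius : ∀ x → (1ℤ ℤ.- x) ℤ.^ p ≈ 1ℤ ℤ.- x ℤ.^ p
  frobenius x = begin
    (1ℤ ℤ.- x) ℤ.^ p                       ≡⟨ cong (ℤ._^ p) (ring₁ x) ⟨
    eval 1-X x ℤ.^ p                       ≡⟨ ℤ.*-identityˡ _ ⟨
    1ℤ ℤ.* eval 1-X x ℤ.^ p                ≡⟨ eval-monomial 1ℤ p (eval 1-X x) ⟨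
    eval (monomial 1ℤ p) (eval 1-X x)      ≡⟨ eval-⟨⟩ (monomial 1ℤ p) 1-X x ⟨
    eval (monomial 1ℤ p ⟨ 1-X ⟩) x         ≈⟨ eval-cong (monomial 1ℤ p ⟨ 1-X ⟩) (1ℤ ∷ monomial -1ℤ q)
                                                (λ k → ≈-trans (≈-reflexive (coeff-⟨1-X⟩ (monomial 1ℤ p) k)) (reflected-X^p k)) x ⟩
    1ℤ ℤ.+ x ℤ.* eval (monomial -1ℤ q) x   ≡⟨ cong (λ t → 1ℤ ℤ.+ x ℤ.* t) (eval-monomial -1ℤ q x) ⟩
    1ℤ ℤ.+ x ℤ.* (-1ℤ ℤ.* x ℤ.^ q)         ≡⟨ ring₂ x (x ℤ.^ q) ⟩
    1ℤ ℤ.- x ℤ.^ p                         ∎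
    where
    open ≈-Reasoning
    ring₁ : ∀ x → 1ℤ ℤ.+ x ℤ.* (-1ℤ ℤ.+ x ℤ.* 0ℤ) ≡ 1ℤ ℤ.- x
    ring₁ = solve-∀
    ring₂ : ∀ x t → 1ℤ ℤ.+ x ℤ.* (-1ℤ ℤ.* t) ≡ 1ℤ ℤ.- x ℤ.* t
    ring₂ = solve-∀

  -- Induction on j through j + 1 = 1 - (-j): apply Frobenius at x = -j, and take the sign out of
  -- (-j)^p by oddness of p.
  fermat : ∀ j → (+ j) ℤ.^ p ≈ + j
  fermat zero    = ≈-refl
  fermat (suc j) = begin
    (1ℤ ℤ.+ + j) ℤ.^ p                ≡⟨ cong (ℤ._^ p) (ring (+ j)) ⟩
    (1ℤ ℤ.- ℤ.- + j) ℤ.^ p            ≈⟨ frobenius (ℤ.- + j) ⟩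
    1ℤ ℤ.- (ℤ.- + j) ℤ.^ p            ≡⟨ cong (λ t → 1ℤ ℤ.- t) (neg-^-odd (+ j) p odd) ⟩
    1ℤ ℤ.- ℤ.- ((+ j) ℤ.^ p)          ≈⟨ +-congˡ 1ℤ (neg-cong (neg-cong (fermat j))) ⟩
    1ℤ ℤ.- ℤ.- + j                    ≡⟨ ring (+ j) ⟨
    + suc j                           ∎
    where
    open ≈-Reasoning
    ring : ∀ x → 1ℤ ℤ.+ x ≡ 1ℤ ℤ.- ℤ.- x
    ring = solve-∀

  -- Polynomials with too many roots modulo p.

  -- Split off the root s. At the root s + i + 1 the cofactor is multiplied by i + 1 < p, which is
  -- invertible, so the cofactor vanishes there. A list of length m has degree below m, so m roots
  -- suffice.
  too-many-roots : ∀ s f → length f + s ≤ p →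
    (∀ i → i < length f → eval f (+ (s + i)) ≈ 0ℤ) → ∀ k → coeff f k ≈ 0ℤ
  too-many-roots s f = go (length f) s f refl
    where
    open ≈-Reasoning
    -- The length is a separate argument because `quotient` is not a structural part of its
    -- polynomial.
    go : ∀ m s f → length f ≡ m → m + s ≤ p →
         (∀ i → i < m → eval f (+ (s + i)) ≈ 0ℤ) → ∀ k → coeff f k ≈ 0ℤ
    go zero    s []      _   _     _     = λ _ → ≈-refl
    go (suc m) s (c ∷ f) len bound roots = quotient-zero (+ s) (c ∷ f) root
      (go m (suc s) (quotient (+ s) (c ∷ f))
        (trans (length-quotient (+ s) c f) (ℕ.suc-injective len))
        (subst (_≤ p) (sym (ℕ.+-suc m s)) bound)
        quotient-root)
      where
      root : eval (c ∷ f) (+ s) ≈ 0ℤ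
      root = subst (λ t → eval (c ∷ f) (+ t) ≈ 0ℤ) (ℕ.+-identityʳ s) (roots 0 z<s)

      quotient-root : ∀ i → i < m → eval (quotient (+ s) (c ∷ f)) (+ (suc s + i)) ≈ 0ℤ
      quotient-root i i<m = cancel-0 {suc i} z<s
        (ℕ.≤-trans (s≤s i<m) (ℕ.≤-trans (ℕ.m≤m+n (suc m) s) bound)) (begin
        + suc i ℤ.* w
          ≡⟨ cong (ℤ._* w) (ring₁ (+ s) (+ i)) ⟩
        (x ℤ.- + s) ℤ.* w
          ≡⟨ ring₂ (eval (c ∷ f) (+ s)) ((x ℤ.- + s) ℤ.* w) ⟩
        (eval (c ∷ f) (+ s) ℤ.+ (x ℤ.- + s) ℤ.* w) ℤ.- eval (c ∷ f) (+ s)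
          ≡⟨ cong (ℤ._- eval (c ∷ f) (+ s)) (eval-quotient (+ s) (c ∷ f) x) ⟨
        eval (c ∷ f) x ℤ.- eval (c ∷ f) (+ s)
          ≈⟨ -‿cong (subst (λ t → eval (c ∷ f) (+ t) ≈ 0ℤ) (ℕ.+-suc s i) (roots (suc i) (s<s i<m))) root ⟩
        0ℤ
          ∎)
        where
        x = + (suc s + i)
        w = eval (quotient (+ s) (c ∷ f)) x
        ring₁ : ∀ s i → 1ℤ ℤ.+ i ≡ 1ℤ ℤ.+ (s ℤ.+ i) ℤ.- s
        ring₁ = solve-∀
        ring₂ : ∀ u t → t ≡ (u ℤ.+ t) ℤ.- u
        ring₂ = solve-∀

  -- Elementary symmetric functions of the inverses.

  -- The n-th elementary symmetric function of a (l + 1), … , a (l + m).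
  e : ℕ → ℕ → ℕ → ℤ
  e zero    l m       = 1ℤ
  e (suc n) l zero    = 0ℤ
  e (suc n) l (suc m) = a (suc l) ℤ.* e n (suc l) m ℤ.+ e (suc n) (suc l) m

  -- The product of 1 + `a i` X over l < i ≤ l + m, multiplied out one factor at a time.
  e-generating : ℕ → ℕ → Poly
  e-generating l zero    = constant 1ℤ
  e-generating l (suc m) = e-generating (suc l) m ⊕ (0ℤ ∷ a (suc l) · e-generating (suc l) m)

  coeff-e-generating : ∀ n l m → coeff (e-generating l m) n ≡ e n l m
  coeff-e-generating zero    l zero    = refl
  coeff-e-generating (suc n) l zero    = refl
  coeff-e-generating zero    l (suc m) = trans
    (coeff-⊕ (e-generating (suc l) m) _ 0)
    (trans (ℤ.+-identityʳ _) (coeff-e-generating zero (suc l) m))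
  coeff-e-generating (suc n) l (suc m) = trans
    (coeff-⊕ (e-generating (suc l) m) _ (suc n))
    (trans
      (cong₂ ℤ._+_ (coeff-e-generating (suc n) (suc l) m)
        (trans (coeff-· (a (suc l)) (e-generating (suc l) m) n)
               (cong (a (suc l) ℤ.*_) (coeff-e-generating n (suc l) m))))
      (ℤ.+-comm (e (suc n) (suc l) m) _))

  length-e-generating : ∀ l m → length (e-generating l m) ≡ suc m
  length-e-generating l zero    = refl
  length-e-generating l (suc m) = begin
    length (e-generating (suc l) m ⊕ (0ℤ ∷ a (suc l) · e-generating (suc l) m))
      ≡⟨ length-⊕ (e-generating (suc l) m) _ ⟩
    length (e-generating (suc l) m) ⊔ suc (length (a (suc l) · e-generating (suc l) m))
      ≡⟨ cong₂ (λ s t → s ⊔ suc t) (length-e-generating (suc l) m)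
           (trans (length-map (a (suc l) ℤ.*_) (e-generating (suc l) m)) (length-e-generating (suc l) m)) ⟩
    suc m ⊔ suc (suc m)
      ≡⟨ ℕ.m≤n⇒m⊔n≡n (ℕ.n≤1+n (suc m)) ⟩
    suc (suc m)
      ∎
    where open ≡.≡-Reasoning

  eval-e-generating : ∀ l m x → eval (e-generating l (suc m)) x
                              ≡ (1ℤ ℤ.+ x ℤ.* a (suc l)) ℤ.* eval (e-generating (suc l) m) x
  eval-e-generating l m x = begin
    eval (g ⊕ (0ℤ ∷ a (suc l) · g)) x
      ≡⟨ eval-⊕ g (0ℤ ∷ a (suc l) · g) x ⟩
    eval g x ℤ.+ (0ℤ ℤ.+ x ℤ.* eval (a (suc l) · g) x)
      ≡⟨ cong (λ t → eval g x ℤ.+ (0ℤ ℤ.+ x ℤ.* t)) (eval-· (a (suc l)) g x) ⟩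
    eval g x ℤ.+ (0ℤ ℤ.+ x ℤ.* (a (suc l) ℤ.* eval g x))
      ≡⟨ ring (a (suc l)) x (eval g x) ⟩
    (1ℤ ℤ.+ x ℤ.* a (suc l)) ℤ.* eval g x
      ∎
    where
    open ≡.≡-Reasoning
    g = e-generating (suc l) m
    ring : ∀ a x u → u ℤ.+ (0ℤ ℤ.+ x ℤ.* (a ℤ.* u)) ≡ (1ℤ ℤ.+ x ℤ.* a) ℤ.* u
    ring = solve-∀

  -- At x = j the factor 1 + x / i with i = p - j vanishes.
  e-generating-root : ∀ {i j} → 0 < i → i + j ≡ p → ∀ l m → l < i → i ≤ l + m →
                      i < p → eval (e-generating l m) (+ j) ≈ 0ℤ
  e-generating-root {i} 0<i i+j≡p l zero l<i i≤l _ =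
    contradiction (subst (i ≤_) (ℕ.+-identityʳ l) i≤l) (ℕ.<⇒≱ l<i)
  e-generating-root {i} {j} 0<i i+j≡p l (suc m) l<i i≤l+m i<p with suc l ℕ.≟ i
  ... | yes refl = begin
    eval (e-generating l (suc m)) (+ j)      ≡⟨ eval-e-generating l m (+ j) ⟩
    (1ℤ ℤ.+ + j ℤ.* a i) ℤ.* g               ≈⟨ *-cong factor≈0 ≈-refl ⟩
    0ℤ                                       ∎
    where
    open ≈-Reasoning
    g = eval (e-generating (suc l) m) (+ j)
    ring : ∀ i j a → i ℤ.* a ℤ.+ j ℤ.* a ≡ (i ℤ.+ j) ℤ.* a
    ring = solve-∀
    factor≈0 : 1ℤ ℤ.+ + j ℤ.* a i ≈ 0ℤ
    factor≈0 = begin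
      1ℤ ℤ.+ + j ℤ.* a i                     ≈⟨ +-cong (reciprocal-< 0<i i<p) ≈-refl ⟨
      + i ℤ.* a i ℤ.+ + j ℤ.* a i            ≡⟨ ring (+ i) (+ j) (a i) ⟩
      + (i + j) ℤ.* a i                      ≡⟨ cong (λ t → + t ℤ.* a i) i+j≡p ⟩
      + p ℤ.* a i                            ≈⟨ *-cong p≈0 ≈-refl ⟩
      0ℤ                                     ∎
  ... | no 1+l≢i = begin
    eval (e-generating l (suc m)) (+ j)                                           ≡⟨ eval-e-generating l m (+ j) ⟩
    (1ℤ ℤ.+ + j ℤ.* a (suc l)) ℤ.* eval (e-generating (suc l) m) (+ j)
      ≈⟨ *-zeroʳ-≈ (1ℤ ℤ.+ + j ℤ.* a (suc l))
           (e-generating-root 0<i i+j≡p (suc l) m (ℕ.≤∧≢⇒< l<i 1+l≢i) (subst (i ≤_) (ℕ.+-suc l m) i≤l+m) i<p) ⟩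
    0ℤ                                                                            ∎
    where open ≈-Reasoning

  -- ∏ (1 + X / i) - 1 + X^q has the p roots 0, … , p - 1, so it vanishes.
  e-vanishes : ∀ {n} → 0 < n → n < q → e n 0 q ≈ 0ℤ
  e-vanishes {n} 0<n n<q = begin
    e n 0 q                                              ≡⟨ coeff-W ⟨
    coeff W n                                            ≈⟨ too-many-roots 0 W length≤p roots n ⟩
    0ℤ                                                   ∎
    where
    open ≈-Reasoning
    G = e-generating 0 q
    W = G ⊕ (constant -1ℤ ⊕ monomial 1ℤ q)

    length-W : length W ≡ p
    length-W rewrite length-⊕ G (constant -1ℤ ⊕ monomial 1ℤ q)
                   | length-⊕ (constant -1ℤ) (monomial 1ℤ q)
                   | length-e-generating 0 q | length-monomial 1ℤ q
      = ℕ.⊔-idem p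

    length≤p : length W + 0 ≤ p
    length≤p = ℕ.≤-reflexive (trans (ℕ.+-identityʳ (length W)) length-W)

    coeff-constant : ∀ {k} → 0 < k → coeff (constant -1ℤ) k ≡ 0ℤ
    coeff-constant (s≤s _) = refl

    -- Because 0 < n < q, neither the constant -1 nor X^q contributes to coefficient n.
    coeff-W : coeff W n ≡ e n 0 q
    coeff-W rewrite coeff-⊕ G (constant -1ℤ ⊕ monomial 1ℤ q) n
                  | coeff-⊕ (constant -1ℤ) (monomial 1ℤ q) n
                  | coeff-constant 0<n
                  | coeff-monomial-≢ 1ℤ (ℕ.<⇒≢ n<q)
                  | coeff-e-generating n 0 q
      = ℤ.+-identityʳ _

    eval-W : ∀ x → eval W x ≡ eval G x ℤ.+ (x ℤ.^ q ℤ.- 1ℤ)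
    eval-W x rewrite eval-⊕ G (constant -1ℤ ⊕ monomial 1ℤ q) x
                   | eval-⊕ (constant -1ℤ) (monomial 1ℤ q) x
                   | eval-monomial 1ℤ q x
      = cong (λ t → eval G x ℤ.+ t) (ring x (x ℤ.^ q))
      where
      ring : ∀ x t → -1ℤ ℤ.+ x ℤ.* 0ℤ ℤ.+ 1ℤ ℤ.* t ≡ t ℤ.- 1ℤ
      ring = solve-∀

    eval-0 : ∀ f → eval f 0ℤ ≡ coeff f 0
    eval-0 []      = refl
    eval-0 (c ∷ f) = ℤ.+-identityʳ c

    0^ : ∀ {m} → 0 < m → 0ℤ ℤ.^ m ≡ 0ℤ
    0^ (s≤s _) = refl

    roots : ∀ i → i < length W → eval W (+ i) ≈ 0ℤ
    roots zero _ = ≈-reflexive (trans (eval-W 0ℤ)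
      (cong₂ (λ s t → s ℤ.+ (t ℤ.- 1ℤ))
        (trans (eval-0 G) (coeff-e-generating 0 0 q))
        (0^ (ℕ.<-trans 0<n n<q))))
    roots (suc j) j<len = begin
      eval W x                               ≡⟨ eval-W x ⟩
      eval G x ℤ.+ (x ℤ.^ q ℤ.- 1ℤ)          ≈⟨ +-cong root (-‿cong x^q≈1 (≈-refl {1ℤ})) ⟩
      0ℤ                                     ∎
      where
      x = + suc j
      j<q : j < q
      j<q = ℕ.≤-pred (subst (suc j <_) length-W j<len)

      -- The vanishing factor belongs to i = q - j, for which i + (j + 1) = p.
      root : eval G x ≈ 0ℤ
      root = e-generating-root {q ℕ.∸ j} (ℕ.m<n⇒0<n∸m j<q)
        (trans (ℕ.+-suc (q ℕ.∸ j) j) (cong suc (ℕ.m∸n+n≡m (ℕ.<⇒≤ j<q)))) 0 q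
        (ℕ.m<n⇒0<n∸m j<q) (ℕ.m∸n≤m q j) (s≤s (ℕ.m∸n≤m q j))

      -- Fermat's congruence x^p ≡ x with one factor x cancelled.
      x^q≈1 : x ℤ.^ q ≈ 1ℤ
      x^q≈1 = cancel z<s (s<s j<q) (≈-trans (fermat (suc j)) (≈-reflexive (sym (ℤ.*-identityʳ x))))

  -- The polynomials modulo p and their differential equation.

  -- Modulo p, Fₙ₊₁ is X times F-tail n 0 q; F-tail n l m lists its coefficients of X^{l+1}, … , X^{l+m}.
  F-tail : ℕ → ℕ → ℕ → Poly
  F-tail n l zero    = []
  F-tail n l (suc m) = a (suc l) ℤ.* e n (suc l) m ∷ F-tail n (suc l) m

  -- Coefficients of the derivative: the exponent i cancels the factor 1/i, leaving the symmetric
  -- function of the later inverses.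
  F-tail′ : ℕ → ℕ → ℕ → Poly
  F-tail′ n l zero    = []
  F-tail′ n l (suc m) = e n (suc l) m ∷ F-tail′ n (suc l) m

  length-F-tail : ∀ n l m → length (F-tail n l m) ≡ m
  length-F-tail n l zero    = refl
  length-F-tail n l (suc m) = cong suc (length-F-tail n (suc l) m)

  -- The constant term of f(1 - X) is the sum of the coefficients of f, and these split the
  -- symmetric function according to the smallest index.
  reflected-F-tail : ∀ n l m → reflected (F-tail n l m) 0 ≡ e (suc n) l m
  reflected-F-tail n l zero    = refl
  reflected-F-tail n l (suc m) = cong (λ t → a (suc l) ℤ.* e n (suc l) m ℤ.+ t) (reflected-F-tail n (suc l) m)

  coeff-F-tail′ : ∀ n l m → l + m ≤ q → ∀ k → + suc (l + k) ℤ.* coeff (F-tail n l m) k ≈ coeff (F-tail′ n l m) k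
  coeff-F-tail′ n l zero    h k    = ≈-reflexive (ℤ.*-zeroʳ (+ suc (l + k)))
  coeff-F-tail′ n l (suc m) h zero = begin
    + suc (l + 0) ℤ.* (a (suc l) ℤ.* u)     ≡⟨ cong (λ t → + suc t ℤ.* (a (suc l) ℤ.* u)) (ℕ.+-identityʳ l) ⟩
    + suc l ℤ.* (a (suc l) ℤ.* u)           ≡⟨ ℤ.*-assoc (+ suc l) (a (suc l)) u ⟨
    + suc l ℤ.* a (suc l) ℤ.* u             ≈⟨ *-cong (reciprocal-< z<s 1+l<p) ≈-refl ⟩
    1ℤ ℤ.* u                                ≡⟨ ℤ.*-identityˡ u ⟩
    u                                       ∎
    where
    open ≈-Reasoning
    u = e n (suc l) m
    1+l<p : suc l < p
    1+l<p = s≤s (ℕ.≤-trans (subst (suc l ≤_) (sym (ℕ.+-suc l m)) (s≤s (ℕ.m≤m+n l m))) h)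
  coeff-F-tail′ n l (suc m) h (suc k) rewrite ℕ.+-suc l k =
    coeff-F-tail′ n (suc l) m (subst (_≤ q) (ℕ.+-suc l m) h) k

  -- The recursion of `e`, read along the list. As polynomials, with f = `F-tail′ (suc n) l m` and g
  -- = `F-tail n l m`, it says (1 - X) f = e - g.
  F-tail′-difference : ∀ n l m k →
    coeff (e (suc n) l m ∷ F-tail′ (suc n) l m) k ≡ coeff (F-tail n l m) k ℤ.+ coeff (F-tail′ (suc n) l m) k
  F-tail′-difference n l zero    zero    = refl
  F-tail′-difference n l zero    (suc k) = refl
  F-tail′-difference n l (suc m) zero    = refl
  F-tail′-difference n l (suc m) (suc k) = F-tail′-difference n (suc l) m k

  -- F₀ = X^p - X with its factor X removed.
  F₀-tail : Poly
  F₀-tail = monomial 1ℤ q ⊕ constant -1ℤ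

  -- Since e₀ = 1, the list is the geometric sum f = 1 + X + ... + X^(m-1), and 1 + X f = f + X^m.
  coeff-F-tail′-0 : ∀ l m k → coeff (1ℤ ∷ F-tail′ 0 l m) k ≡ coeff (F-tail′ 0 l m) k ℤ.+ coeff (monomial 1ℤ m) k
  coeff-F-tail′-0 l zero    zero    = refl
  coeff-F-tail′-0 l zero    (suc k) = refl
  coeff-F-tail′-0 l (suc m) zero    = refl
  coeff-F-tail′-0 l (suc m) (suc k) = coeff-F-tail′-0 (suc l) m k

  tail : ℕ → Poly
  tail zero    = F₀-tail
  tail (suc n) = F-tail n 0 q

  D-tail : ∀ n k → coeff (D (0ℤ ∷ F-tail n 0 q)) k ≈ coeff (F-tail′ n 0 q) k
  D-tail n k = ≈-trans (≈-reflexive (coeff-D (0ℤ ∷ F-tail n 0 q) k)) (coeff-F-tail′ n 0 q ℕ.≤-refl k)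

  -- x(1 - x) F₁′ = x - x^p, and x(1 - x) Fₙ₊₁′ = x e_n(1, … , 1/q) - Fₙ for n ≥ 1.
  derivative-tail : ∀ n → n < q → ∀ k → coeff (1-X∙ D (0ℤ ∷ tail (suc n))) k ≈ ℤ.- coeff (tail n) k
  derivative-tail zero 0<q zero = begin
    coeff (1-X∙ D (0ℤ ∷ tail 1)) 0        ≡⟨ coeff-1-X∙-zero (D (0ℤ ∷ tail 1)) ⟩
    coeff (D (0ℤ ∷ tail 1)) 0             ≈⟨ D-tail 0 0 ⟩
    coeff (F-tail′ 0 0 q) 0               ≡⟨ ring (coeff (F-tail′ 0 0 q) 0) (coeff (monomial 1ℤ q) 0) ⟩
    (coeff (F-tail′ 0 0 q) 0 ℤ.+ coeff (monomial 1ℤ q) 0) ℤ.- coeff (monomial 1ℤ q) 0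
                                          ≡⟨ cong (ℤ._- coeff (monomial 1ℤ q) 0) (coeff-F-tail′-0 0 q 0) ⟨
    1ℤ ℤ.- coeff (monomial 1ℤ q) 0        ≡⟨ ring′ (coeff (monomial 1ℤ q) 0) ⟩
    ℤ.- (coeff (monomial 1ℤ q) 0 ℤ.+ -1ℤ) ≡⟨ cong ℤ.-_ (coeff-⊕ (monomial 1ℤ q) (constant -1ℤ) 0) ⟨
    ℤ.- coeff F₀-tail 0                   ∎
    where
    open ≈-Reasoning
    ring : ∀ u v → u ≡ (u ℤ.+ v) ℤ.- v
    ring = solve-∀
    ring′ : ∀ v → 1ℤ ℤ.- v ≡ ℤ.- (v ℤ.+ -1ℤ)
    ring′ = solve-∀
  derivative-tail zero 0<q (suc k) = begin
    coeff (1-X∙ D (0ℤ ∷ tail 1)) (suc k)            ≡⟨ coeff-1-X∙-suc (D (0ℤ ∷ tail 1)) k ⟩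
    coeff (D (0ℤ ∷ tail 1)) (suc k) ℤ.- coeff (D (0ℤ ∷ tail 1)) k
                                                    ≈⟨ -‿cong (D-tail 0 (suc k)) (D-tail 0 k) ⟩
    coeff (F-tail′ 0 0 q) (suc k) ℤ.- coeff (F-tail′ 0 0 q) k
                                                    ≡⟨ cong (λ t → coeff (F-tail′ 0 0 q) (suc k) ℤ.- t) (coeff-F-tail′-0 0 q (suc k)) ⟩
    coeff (F-tail′ 0 0 q) (suc k) ℤ.- (coeff (F-tail′ 0 0 q) (suc k) ℤ.+ coeff (monomial 1ℤ q) (suc k))
                                                    ≡⟨ ring (coeff (F-tail′ 0 0 q) (suc k)) (coeff (monomial 1ℤ q) (suc k)) ⟩
    ℤ.- (coeff (monomial 1ℤ q) (suc k) ℤ.+ 0ℤ)      ≡⟨ cong ℤ.-_ (coeff-⊕ (monomial 1ℤ q) (constant -1ℤ) (suc k)) ⟨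
    ℤ.- coeff F₀-tail (suc k)                       ∎
    where
    open ≈-Reasoning
    ring : ∀ u v → u ℤ.- (u ℤ.+ v) ≡ ℤ.- (v ℤ.+ 0ℤ)
    ring = solve-∀
  derivative-tail (suc n) n<q zero = begin
    coeff (1-X∙ D (0ℤ ∷ tail (suc (suc n)))) 0      ≡⟨ coeff-1-X∙-zero (D (0ℤ ∷ tail (suc (suc n)))) ⟩
    coeff (D (0ℤ ∷ tail (suc (suc n)))) 0           ≈⟨ D-tail (suc n) 0 ⟩
    v                                               ≡⟨ ring u v ⟩
    (u ℤ.+ v) ℤ.- u                                 ≡⟨ cong (ℤ._- u) (F-tail′-difference n 0 q 0) ⟨
    -- With the factor x removed, the term with the symmetric function affects only this constant
    -- coefficient, and it vanishes modulo p.
    e (suc n) 0 q ℤ.- u                             ≈⟨ -‿cong (e-vanishes z<s n<q) (≈-refl {u}) ⟩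
    0ℤ ℤ.- u                                        ≡⟨ ℤ.+-identityˡ _ ⟩
    ℤ.- u                                           ∎
    where
    open ≈-Reasoning
    u = coeff (F-tail n 0 q) 0
    v = coeff (F-tail′ (suc n) 0 q) 0
    ring : ∀ u v → v ≡ (u ℤ.+ v) ℤ.- u
    ring = solve-∀
  derivative-tail (suc n) n<q (suc k) = begin
    coeff (1-X∙ D (0ℤ ∷ tail (suc (suc n)))) (suc k)  ≡⟨ coeff-1-X∙-suc (D (0ℤ ∷ tail (suc (suc n)))) k ⟩
    coeff (D (0ℤ ∷ tail (suc (suc n)))) (suc k) ℤ.- coeff (D (0ℤ ∷ tail (suc (suc n)))) k
                                                      ≈⟨ -‿cong (D-tail (suc n) (suc k)) (D-tail (suc n) k) ⟩
    v ℤ.- coeff (F-tail′ (suc n) 0 q) k               ≡⟨ cong (λ t → v ℤ.- t) (F-tail′-difference n 0 q (suc k)) ⟩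
    v ℤ.- (u ℤ.+ v)                                   ≡⟨ ring u v ⟩
    ℤ.- u                                             ∎
    where
    open ≈-Reasoning
    u = coeff (F-tail n 0 q) (suc k)
    v = coeff (F-tail′ (suc n) 0 q) (suc k)
    ring : ∀ u v → v ℤ.- (u ℤ.+ v) ≡ ℤ.- u
    ring = solve-∀

  -- The symmetry modulo p.

  -- (-1)^(n-1), continued to n = 0 by -1, the sign in F₀(1 - x) = - F₀(x).
  sign : ℕ → ℤ
  sign zero    = -1ℤ
  sign (suc n) = -1ℤ ℤ.^ n

  sign-suc : ∀ n → sign (suc n) ≡ ℤ.- sign n
  sign-suc zero    = refl
  sign-suc (suc n) = ℤ.-1*i≡-i (-1ℤ ℤ.^ n)

  -- In degrees p and above both sides are zero by length. Derivatives give no information in degree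
  -- p, since k + 1 = p is not invertible.
  symmetric-beyond : ∀ n {k} → q ≤ k →
    reflected (0ℤ ∷ tail (suc n)) (suc k) ≈ sign (suc n) ℤ.* coeff (0ℤ ∷ tail (suc n)) (suc k)
  symmetric-beyond n {k} q≤k = ≈-reflexive (trans
    (reflected-beyond (0ℤ ∷ tail (suc n)) (s≤s length≤k))
    (sym (trans (cong (sign (suc n) ℤ.*_) (coeff-beyond (tail (suc n)) length≤k))
                (ℤ.*-zeroʳ (sign (suc n))))))
    where
    length≤k : length (tail (suc n)) ≤ k
    length≤k = subst (_≤ k) (sym (length-F-tail n 0 q)) q≤k

  symmetric-tail : ∀ n → n < q → ∀ k → reflected (0ℤ ∷ tail n) k ≈ sign n ℤ.* coeff (0ℤ ∷ tail n) k
  symmetric-tail zero 0<q k = begin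
    reflected (0ℤ ∷ F₀-tail) k
      ≡⟨ reflected-⊕ (monomial 1ℤ p) (0ℤ ∷ constant -1ℤ) k ⟩
    reflected (monomial 1ℤ p) k ℤ.+ reflected (0ℤ ∷ constant -1ℤ) k
      ≈⟨ +-cong (reflected-X^p k) (≈-refl {reflected (0ℤ ∷ constant -1ℤ) k}) ⟩
    coeff (1ℤ ∷ monomial -1ℤ q) k ℤ.+ reflected (0ℤ ∷ constant -1ℤ) k
      ≡⟨ antisymmetric k ⟩
    -1ℤ ℤ.* (coeff (monomial 1ℤ p) k ℤ.+ coeff (0ℤ ∷ constant -1ℤ) k)
      ≡⟨ cong (-1ℤ ℤ.*_) (coeff-⊕ (monomial 1ℤ p) (0ℤ ∷ constant -1ℤ) k) ⟨
    -1ℤ ℤ.* coeff (0ℤ ∷ F₀-tail) k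
      ∎
    where
    open ≈-Reasoning
    coeff-monomial-neg : ∀ m k → coeff (monomial -1ℤ m) k ≡ ℤ.- coeff (monomial 1ℤ m) k
    coeff-monomial-neg zero    zero    = refl
    coeff-monomial-neg zero    (suc k) = refl
    coeff-monomial-neg (suc m) zero    = refl
    coeff-monomial-neg (suc m) (suc k) = coeff-monomial-neg m k

    ring₁ : ∀ t → ℤ.- t ℤ.+ 1ℤ ≡ -1ℤ ℤ.* (t ℤ.+ -1ℤ)
    ring₁ = solve-∀
    ring₂ : ∀ t → ℤ.- t ℤ.+ 0ℤ ≡ -1ℤ ℤ.* (t ℤ.+ 0ℤ)
    ring₂ = solve-∀

    antisymmetric : ∀ k → coeff (1ℤ ∷ monomial -1ℤ q) k ℤ.+ reflected (0ℤ ∷ constant -1ℤ) k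
                        ≡ -1ℤ ℤ.* (coeff (monomial 1ℤ p) k ℤ.+ coeff (0ℤ ∷ constant -1ℤ) k)
    antisymmetric zero          = refl
    antisymmetric (suc zero)    =
      trans (cong (ℤ._+ 1ℤ) (coeff-monomial-neg q 0)) (ring₁ (coeff (monomial 1ℤ q) 0))
    antisymmetric (suc (suc k)) =
      trans (cong (ℤ._+ 0ℤ) (coeff-monomial-neg q (suc k))) (ring₂ (coeff (monomial 1ℤ q) (suc k)))
  -- The constant term of the reflected polynomial is the value at 1, while the polynomial itself
  -- has constant term 0.
  symmetric-tail (suc n) n<q zero = begin
    0ℤ ℤ.+ reflected (F-tail n 0 q) 0     ≡⟨ ℤ.+-identityˡ _ ⟩
    reflected (F-tail n 0 q) 0            ≡⟨ reflected-F-tail n 0 q ⟩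
    e (suc n) 0 q                         ≈⟨ e-vanishes z<s n<q ⟩
    0ℤ                                    ≡⟨ ℤ.*-zeroʳ (sign (suc n)) ⟨
    sign (suc n) ℤ.* 0ℤ                   ∎
    where open ≈-Reasoning
  symmetric-tail (suc n) n<q (suc k) with ℕ.<-cmp k q
  -- Degrees 1 to p - 1: compare derivatives and cancel k + 1. The chain rule for 1 - x flips the
  -- sign.
  ... | tri< k<q _ _ = cancel z<s (s<s k<q) (begin
    + suc k ℤ.* reflected f (suc k)                ≡⟨ reflected-D f k ⟩
    ℤ.- reflected (D f) k                          ≈⟨ neg-cong (reflected-derivative f (tail n) (sign n)
                                                        (derivative-tail n n<q′) (symmetric-tail n n<q′) k) ⟩
    ℤ.- (sign n ℤ.* coeff (D f) k)                 ≡⟨ cong (λ t → ℤ.- (sign n ℤ.* t)) (coeff-D f k) ⟩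
    ℤ.- (sign n ℤ.* (+ suc k ℤ.* coeff f (suc k))) ≡⟨ ring (sign n) (+ suc k) (coeff f (suc k)) ⟩
    + suc k ℤ.* (ℤ.- sign n ℤ.* coeff f (suc k))   ≡⟨ cong (λ t → + suc k ℤ.* (t ℤ.* coeff f (suc k))) (sign-suc n) ⟨
    + suc k ℤ.* (sign (suc n) ℤ.* coeff f (suc k)) ∎)
    where
    open ≈-Reasoning
    f = 0ℤ ∷ tail (suc n)
    n<q′ : n < q
    n<q′ = ℕ.<-trans (ℕ.n<1+n n) n<q
    ring : ∀ s i u → ℤ.- (s ℤ.* (i ℤ.* u)) ≡ i ℤ.* (ℤ.- s ℤ.* u)
    ring = solve-∀
  ... | tri≈ _ refl _ = symmetric-beyond n (ℕ.≤-refl)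
  ... | tri> _ _ q<k  = symmetric-beyond n (ℕ.<⇒≤ q<k)

  -- Sums over increasing tuples.

  ∑ᶻ-increasing : ∀ n l m → l + m ≡ q → (φ : Vec ℕ (suc n) → ℤ) →
    ∑ᶻ φ (increasing p (suc n) l) ≡ ∑ᶻ (λ i → ∑ᶻ (λ is → φ (i ∷ᵥ is)) (increasing p n i)) (interval l m)
  ∑ᶻ-increasing n l m refl φ = begin
    ∑ᶻ φ (increasing p (suc n) l)
      ≡⟨ ∑ᶻ-concatMap φ (λ i → map (i ∷ᵥ_) (increasing p n i)) (filter (l ℕ.<?_) (upTo p)) ⟩
    ∑ᶻ (λ i → ∑ᶻ φ (map (i ∷ᵥ_) (increasing p n i))) (filter (l ℕ.<?_) (upTo p))
      ≡⟨ cong (∑ᶻ _) (filter-upTo l m) ⟩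
    ∑ᶻ (λ i → ∑ᶻ φ (map (i ∷ᵥ_) (increasing p n i))) (interval l m)
      ≡⟨ ∑ᶻ-cong (λ i → ∑ᶻ-map φ (i ∷ᵥ_) (increasing p n i)) (interval l m) ⟩
    ∑ᶻ (λ i → ∑ᶻ (λ is → φ (i ∷ᵥ is)) (increasing p n i)) (interval l m)
      ∎
    where open ≡.≡-Reasoning

  -- Both sides are inverse to c d modulo p. Coprimality replaces the bound below p, because
  -- products of indices may exceed p.
  reciprocal-* : ∀ {c d} → Coprime c p → Coprime d p → a (c ℕ.* d) ≈ a c ℤ.* a d
  reciprocal-* {c} {d} c⊥p d⊥p = cancel-coprime cd⊥p (begin
    + (c ℕ.* d) ℤ.* a (c ℕ.* d)             ≈⟨ reciprocal cd⊥p ⟩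
    1ℤ ℤ.* 1ℤ                               ≈⟨ *-cong (reciprocal c⊥p) (reciprocal d⊥p) ⟨
    + c ℤ.* a c ℤ.* (+ d ℤ.* a d)           ≡⟨ ring (+ c) (+ d) (a c) (a d) ⟩
    + c ℤ.* + d ℤ.* (a c ℤ.* a d)           ≡⟨ cong (ℤ._* (a c ℤ.* a d)) (ℤ.pos-* c d) ⟨
    + (c ℕ.* d) ℤ.* (a c ℤ.* a d)           ∎)
    where
    open ≈-Reasoning
    cd⊥p : Coprime (c ℕ.* d) p
    cd⊥p = coprime-* c⊥p d⊥p
    ring : ∀ c d x y → c ℤ.* x ℤ.* (d ℤ.* y) ≡ c ℤ.* d ℤ.* (x ℤ.* y)
    ring = solve-∀

  interval-bound : ∀ l m → l + suc m ≡ q → suc l < p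
  interval-bound l m refl = s≤s (subst (suc l ≤_) (sym (ℕ.+-suc l m)) (s≤s (ℕ.m≤m+n l m)))

  -- The factor c accumulates the indices already chosen; the induction on n passes from c to c i.
  ∑ᶻ-reciprocals : ∀ n l m → l + m ≡ q → ∀ c → Coprime c p →
    ∑ᶻ (λ is → a (c ℕ.* product (toList is))) (increasing p n l) ≈ a c ℤ.* e n l m
  ∑ᶻ-reciprocals zero    l m eq c c⊥p = ≈-reflexive (begin
    a (c ℕ.* 1) ℤ.+ 0ℤ     ≡⟨ ℤ.+-identityʳ _ ⟩
    a (c ℕ.* 1)            ≡⟨ cong a (ℕ.*-identityʳ c) ⟩
    a c                    ≡⟨ ℤ.*-identityʳ (a c) ⟨
    a c ℤ.* 1ℤ             ∎)
    where open ≡.≡-Reasoning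
  ∑ᶻ-reciprocals (suc n) l m eq c c⊥p =
    ≈-trans (≈-reflexive (∑ᶻ-increasing n l m eq (λ is → a (c ℕ.* product (toList is))))) (go l m eq)
    where
    open ≈-Reasoning
    ring : ∀ c i x y → c ℤ.* i ℤ.* x ℤ.+ c ℤ.* y ≡ c ℤ.* (i ℤ.* x ℤ.+ y)
    ring = solve-∀

    -- Inner induction over the range of the next index, parallel to the recursion of `e (suc n)`.
    go : ∀ l m → l + m ≡ q →
      ∑ᶻ (λ i → ∑ᶻ (λ is → a (c ℕ.* (i ℕ.* product (toList is)))) (increasing p n i)) (interval l m)
        ≈ a c ℤ.* e (suc n) l m
    go l zero    eq = ≈-reflexive (sym (ℤ.*-zeroʳ (a c)))
    go l (suc m) eq = begin
      ∑ᶻ (λ is → a (c ℕ.* (i ℕ.* product (toList is)))) (increasing p n i) ℤ.+ rest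
        ≡⟨ cong (ℤ._+ rest) (∑ᶻ-cong (λ is → cong a (sym (ℕ.*-assoc c i (product (toList is))))) (increasing p n i)) ⟩
      ∑ᶻ (λ is → a (c ℕ.* i ℕ.* product (toList is))) (increasing p n i) ℤ.+ rest
        ≈⟨ +-cong (∑ᶻ-reciprocals n i m eq′ (c ℕ.* i) (coprime-* c⊥p i⊥p)) (go i m eq′) ⟩
      a (c ℕ.* i) ℤ.* e n i m ℤ.+ a c ℤ.* e (suc n) i m
        ≈⟨ +-cong (*-cong (reciprocal-* c⊥p i⊥p) (≈-refl {e n i m})) (≈-refl {a c ℤ.* e (suc n) i m}) ⟩
      a c ℤ.* a i ℤ.* e n i m ℤ.+ a c ℤ.* e (suc n) i m
        ≡⟨ ring (a c) (a i) (e n i m) (e (suc n) i m) ⟩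
      a c ℤ.* (a i ℤ.* e n i m ℤ.+ e (suc n) i m)
        ∎
      where
      i = suc l
      eq′ : i + m ≡ q
      eq′ = trans (sym (ℕ.+-suc l m)) eq
      i⊥p : Coprime i p
      i⊥p = small-coprime z<s (interval-bound l m eq)
      rest = ∑ᶻ (λ i → ∑ᶻ (λ is → a (c ℕ.* (i ℕ.* product (toList is)))) (increasing p n i)) (interval i m)

  F̄ : ℕ → Poly
  F̄ n = ∑ (map (λ is → monomial (a (product (toList is))) (head is)) (increasing p (suc n) 0))

  -- Sort the tuples by their first index i, which is also the exponent: the remaining indices sum
  -- to `e n` of the inverses beyond i.
  coeff-F̄ : ∀ n k → coeff (F̄ n) k ≈ coeff (0ℤ ∷ F-tail n 0 q) k
  coeff-F̄ n k = begin
    coeff (F̄ n) k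
      ≡⟨ coeff-∑ (λ is → monomial (a (product (toList is))) (head is)) (increasing p (suc n) 0) k ⟩
    ∑ᶻ (λ is → coeff (monomial (a (product (toList is))) (head is)) k) (increasing p (suc n) 0)
      ≡⟨ ∑ᶻ-increasing n 0 q refl (λ is → coeff (monomial (a (product (toList is))) (head is)) k) ⟩
    ∑ᶻ (λ i → ∑ᶻ (λ is → coeff (monomial (a (i ℕ.* product (toList is))) i) k) (increasing p n i)) (interval 0 q)
      ≈⟨ go 0 q refl ⟩
    coeff (shift 1 (F-tail n 0 q)) k
      ∎
    where
    open ≈-Reasoning
    go : ∀ l m → l + m ≡ q →
      ∑ᶻ (λ i → ∑ᶻ (λ is → coeff (monomial (a (i ℕ.* product (toList is))) i) k) (increasing p n i)) (interval l m)
        ≈ coeff (shift (suc l) (F-tail n l m)) k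
    go l zero    eq = ≈-reflexive (sym (shift-[] (suc l) k))
      where
      shift-[] : ∀ i k → coeff (shift i []) k ≡ 0ℤ
      shift-[] zero    k       = refl
      shift-[] (suc i) zero    = refl
      shift-[] (suc i) (suc k) = shift-[] i k
    go l (suc m) eq = begin
      ∑ᶻ (λ is → coeff (monomial (a (i ℕ.* product (toList is))) i) k) (increasing p n i) ℤ.+ rest
        ≈⟨ +-cong (≈-trans (≈-reflexive (coeff-monomial-∑ᶻ _ i k (increasing p n i)))
                           (coeff-monomial-cong (∑ᶻ-reciprocals n i m eq′ i i⊥p) i k))
                  (go i m eq′) ⟩
      coeff (monomial (a i ℤ.* e n i m) i) k ℤ.+ coeff (shift (suc i) (F-tail n i m)) k
        ≡⟨ coeff-shift-∷ (a i ℤ.* e n i m) (F-tail n i m) i k ⟩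
      coeff (shift i (F-tail n l (suc m))) k
        ∎
      where
      i = suc l
      eq′ : i + m ≡ q
      eq′ = trans (sym (ℕ.+-suc l m)) eq
      i⊥p : Coprime i p
      i⊥p = small-coprime z<s (interval-bound l m eq)
      rest = ∑ᶻ (λ i → ∑ᶻ (λ is → coeff (monomial (a (i ℕ.* product (toList is))) i) k) (increasing p n i)) (interval i m)

  symmetric-F̄ : ∀ n → suc n < q → ∀ k → reflected (F̄ n) k ≈ -1ℤ ℤ.^ n ℤ.* coeff (F̄ n) k
  symmetric-F̄ n n<q k = begin
    reflected (F̄ n) k                            ≈⟨ reflected-cong (F̄ n) (0ℤ ∷ tail (suc n)) (coeff-F̄ n) k ⟩
    reflected (0ℤ ∷ tail (suc n)) k              ≈⟨ symmetric-tail (suc n) n<q k ⟩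
    -1ℤ ℤ.^ n ℤ.* coeff (0ℤ ∷ tail (suc n)) k    ≈⟨ *-congˡ (-1ℤ ℤ.^ n) (coeff-F̄ n k) ⟨
    -1ℤ ℤ.^ n ℤ.* coeff (F̄ n) k                  ∎
    where open ≈-Reasoning

-- Reduction from the p-adic integers.

module Reduction (p : ℕ) where

  open IntegerPolynomials

  open Padic p using (ℤₚ; ι; residue; coherent; mk≈; congruent; ℤₚ-commutativeRing; 1/_; 1/-correct)
  open Congruence p using (_≈_; mk≈)
  module P = Polynomial ℤₚ-commutativeRing
  open CommutativeRing ℤₚ-commutativeRing using (semiring; 1#; -_)
  open import Algebra.Properties.Semiring.Divisibility semiring using (_∣_; _,_)
  module E = Exp semiring

  -- A representative of the class in ℤₚ / p.
  ρ : ℤₚ → ℤ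
  ρ x = residue x 1

  p∣p^1+k : ∀ k → + p ℤ.∣ (+ p) ℤ.^ suc k
  p∣p^1+k k = divides ((+ p) ℤ.^ k) (ℤ.*-comm (+ p) ((+ p) ℤ.^ k))

  ρ-reciprocal : ∀ {m} → Coprime m p → + m ℤ.* ρ (1/ m) ≈ 1ℤ
  ρ-reciprocal {m} m⊥p = mk≈ (ℤ.∣-trans (p∣p^1+k 0) (congruent (1/-correct m m⊥p) 1))

  ρ-^ : ∀ x n → ρ (x E.^ n) ≡ ρ x ℤ.^ n
  ρ-^ x zero    = refl
  ρ-^ x (suc n) = cong (ρ x ℤ.*_) (ρ-^ x n)

  coeff-ρ : ∀ f k → ρ (P.coeff f k) ≡ coeff (map ρ f) k
  coeff-ρ []      k       = refl
  coeff-ρ (a ∷ f) zero    = refl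
  coeff-ρ (a ∷ f) (suc k) = coeff-ρ f k

  -- The operations of ℤₚ act on residues index by index, so reduction commutes with polynomial
  -- operations as an equality of lists, not merely up to congruence.
  ρ-⊕ : ∀ f g → map ρ (f P.⊕ g) ≡ map ρ f ⊕ map ρ g
  ρ-⊕ []      g       = refl
  ρ-⊕ (a ∷ f) []      = refl
  ρ-⊕ (a ∷ f) (b ∷ g) = cong (_ ∷_) (ρ-⊕ f g)

  ρ-· : ∀ a f → map ρ (a P.· f) ≡ ρ a · map ρ f
  ρ-· a []      = refl
  ρ-· a (b ∷ f) = cong (_ ∷_) (ρ-· a f)

  ρ-neg : ∀ f → map ρ (map -_ f) ≡ map ℤ.-_ (map ρ f)
  ρ-neg []      = refl
  ρ-neg (a ∷ f) = cong (_ ∷_) (ρ-neg f)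

  ρ-⊗ : ∀ f g → map ρ (f P.⊗ g) ≡ map ρ f ⊗ map ρ g
  ρ-⊗ []      g = refl
  ρ-⊗ (a ∷ f) g = trans (ρ-⊕ (a P.· g) _) (cong₂ (λ s t → s ⊕ (0ℤ ∷ t)) (ρ-· a g) (ρ-⊗ f g))

  ρ-⟨⟩ : ∀ f g → map ρ (f P.⟨ g ⟩) ≡ map ρ f ⟨ map ρ g ⟩
  ρ-⟨⟩ []      g = refl
  ρ-⟨⟩ (a ∷ f) g = trans (ρ-⊕ (P.constant a) (g P.⊗ f P.⟨ g ⟩))
    (cong (constant (ρ a) ⊕_) (trans (ρ-⊗ g (f P.⟨ g ⟩)) (cong (map ρ g ⊗_) (ρ-⟨⟩ f g))))

  ρ-monomial : ∀ a m → map ρ (P.monomial a m) ≡ monomial (ρ a) m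
  ρ-monomial a zero    = refl
  ρ-monomial a (suc m) = cong (0ℤ ∷_) (ρ-monomial a m)

  ρ-∑ : ∀ {A : Set} (g : A → P.Poly) (h : A → Poly) → (∀ x → map ρ (g x) ≡ h x) →
        ∀ xs → map ρ (P.∑ (map g xs)) ≡ ∑ (map h xs)
  ρ-∑ g h eq []       = refl
  ρ-∑ g h eq (x ∷ xs) = trans (ρ-⊕ (g x) _) (cong₂ _⊕_ (eq x) (ρ-∑ g h eq xs))

  -- From index 1 on, coherence makes consecutive residues agree modulo p. Index 0 is excluded,
  -- being known only modulo p^0 = 1.
  ρ-residue : ∀ x → + p ℤ.∣ ρ x → ∀ k → + p ℤ.∣ residue x (suc k)
  ρ-residue x p∣ρx zero    = p∣ρx
  ρ-residue x p∣ρx (suc k) = subst (+ p ℤ.∣_) (ring (residue x (suc (suc k))) (residue x (suc k)))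
    (ℤ.∣m∣n⇒∣m+n (ℤ.∣-trans (p∣p^1+k k) (coherent x (suc k))) (ρ-residue x p∣ρx k))
    where
    ring : ∀ u v → u ℤ.- v ℤ.+ v ≡ u
    ring = solve-∀

  -- The quotient x / p has residue x (k + 1) / p as its residue mod p^k.
  ρ-divisible : .{{_ : NonZero p}} → ∀ x → + p ℤ.∣ ρ x → ι (+ p) ∣ x
  ρ-divisible x p∣ρx = y , mk≈ λ k →
    -- At index k the product of y and p is `residue x (suc k)`, which coherence compares with
    -- `residue x k`.
    subst (λ t → (+ p) ℤ.^ k ℤ.∣ t ℤ.- residue x k) (divides-≡ k) (coherent x k)
    where
    quot : ℕ → ℤ
    quot k = ℤ.quotient (ρ-residue x p∣ρx k)

    divides-≡ : ∀ k → residue x (suc k) ≡ quot k ℤ.* + p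
    divides-≡ k = ℤ._∣_.equality (ρ-residue x p∣ρx k)

    factor : ∀ k → residue x (suc (suc k)) ℤ.- residue x (suc k) ≡ + p ℤ.* (quot (suc k) ℤ.- quot k)
    factor k = trans (cong₂ ℤ._-_ (divides-≡ (suc k)) (divides-≡ k)) (ring (quot (suc k)) (quot k) (+ p))
      where
      ring : ∀ u v p → u ℤ.* p ℤ.- v ℤ.* p ≡ p ℤ.* (u ℤ.- v)
      ring = solve-∀

    y : ℤₚ
    y = record
      { residue  = quot
      -- Cancelling p costs one power of p; the index shift in `quot` provides it.
      ; coherent = λ k → ℤ.*-cancelˡ-∣ (+ p) (subst ((+ p) ℤ.^ suc k ℤ.∣_) (factor k) (coherent x (suc k)))
      }

-- The theorem over the p-adic integers.

private
  2<-prime-odd : ∀ {p} → Prime p → 2 < p → ¬ 2 ℕ.∣ p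
  2<-prime-odd p-prime 2<p 2∣p with prime⇒irreducible p-prime 2∣p
  ... | inj₂ refl = ℕ.<-irrefl refl 2<p

theorem1p2 : (n p : ℕ) .{{_ : NonZero n}} → Prime p → n + 1 < p →
    let open CommutativeRing (Padic.ℤₚ-commutativeRing p)
        open Exp semiring using (_^_)
        open Polynomial (Padic.ℤₚ-commutativeRing p)
    in F p n ⟨ constant 1# ⊖ X ⟩ ≡ ((- 1#) ^ pred n) · F p n [mod Padic.ι p (+ p) ]
theorem1p2 (suc n) p@(suc q) p-prime n+1<p k = ρ-divisible difference
  (subst (+ p ℤ.∣_) (sym ρ-difference) (divisible (symmetric-F̄ n n<q k)))
  where
  open IntegerPolynomials
  open Reduction p
  open Congruence p using (divisible)
  open CommutativeRing (Padic.ℤₚ-commutativeRing p) using (1#; -_)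

  n<q : suc n < q
  n<q = ℕ.≤-pred (subst (λ t → suc (suc t) ≤ p) (ℕ.+-comm n 1) n+1<p)

  odd : ¬ 2 ℕ.∣ p
  odd = 2<-prime-odd p-prime (s≤s (ℕ.≤-trans (s≤s (s≤s z≤n)) n<q))

  -- The inverses modulo p are the reductions of the p-adic inverses 1/m.
  open Reciprocals q p-prime odd (λ m → ρ (Padic.1/_ p m)) ρ-reciprocal

  1-Xₚ f εf : P.Poly
  1-Xₚ = P.constant 1# P.⊖ P.X
  f    = F p (suc n)
  εf   = ((- 1#) E.^ n) P.· f

  difference : Padic.ℤₚ p
  difference = P.coeff (f P.⟨ 1-Xₚ ⟩ P.⊖ εf) k

  ρ-F : map ρ f ≡ F̄ n
  ρ-F = ρ-∑ _ _ (λ is → ρ-monomial _ (head is)) (increasing p (suc n) 0)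

  ρ-difference : ρ difference ≡ reflected (F̄ n) k ℤ.- -1ℤ ℤ.^ n ℤ.* coeff (F̄ n) k
  ρ-difference = begin
    ρ difference
      ≡⟨ coeff-ρ (f P.⟨ 1-Xₚ ⟩ P.⊖ εf) k ⟩
    coeff (map ρ (f P.⟨ 1-Xₚ ⟩ P.⊖ εf)) k
      ≡⟨ cong (λ g → coeff g k) (trans (ρ-⊕ (f P.⟨ 1-Xₚ ⟩) (map -_ εf)) (cong₂ _⊕_ (ρ-⟨⟩ f 1-Xₚ) (ρ-neg εf))) ⟩
    -- `map ρ 1-Xₚ` computes to `1-X`.
    coeff (map ρ f ⟨ 1-X ⟩ ⊖ map ρ εf) k
      ≡⟨ cong₂ (λ g h → coeff (g ⟨ 1-X ⟩ ⊖ h) k) ρ-F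
           (trans (ρ-· ((- 1#) E.^ n) f) (cong₂ _·_ (ρ-^ (- 1#) n) ρ-F)) ⟩
    coeff (F̄ n ⟨ 1-X ⟩ ⊖ (-1ℤ ℤ.^ n) · F̄ n) k
      ≡⟨ coeff-⊕ (F̄ n ⟨ 1-X ⟩) _ k ⟩
    coeff (F̄ n ⟨ 1-X ⟩) k ℤ.+ coeff (map ℤ.-_ ((-1ℤ ℤ.^ n) · F̄ n)) k
      ≡⟨ cong₂ ℤ._+_ (coeff-⟨1-X⟩ (F̄ n) k)
           (trans (coeff-neg ((-1ℤ ℤ.^ n) · F̄ n) k) (cong ℤ.-_ (coeff-· (-1ℤ ℤ.^ n) (F̄ n) k))) ⟩
    reflected (F̄ n) k ℤ.- -1ℤ ℤ.^ n ℤ.* coeff (F̄ n) k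
      ∎
    where open ≡.≡-Reasoning
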